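{- Let $1\leq m\leq n/2$. The sets $$T(n,m)\times\prod_{X\in B(n)_{m-1}}\mathcal{DU}(X)\qquad\text{and}\qquad T(n,m-1)\times\prod_{X\in B(n)_m}\mathcal{UD}(X)$$ have the same cardinality.
   Context: $B(n)_k$ is the set of $k$-element subsets of $\{1,\ldots,n\}$. For $0\leq m\leq n/2$, the Johnson graph $C(n,m)$ has vertex set $B(n)_m$, with $X,Y$ adjacent iff $|X\cap Y|=m-1$. A rooted spanning tree of a graph is a spanning tree together with a choice of a vertex as root; $T(n,m)$ is the set of rooted spanning trees of $C(n,m)$. For $1\leq k\leq n$, $X\in B(n)_k$, $X'\in B(n)_{k-1}$: $\mathcal{UD}(X)=\{(Y,Z)\in B(n)_{k-1}\times B(n)_k: X\supseteq Y\subseteq Z\}$ and $\mathcal{DU}(X')=\{(Y',Z')\in B(n)_k\times B(n)_{k-1}: X'\subseteq Y'\supseteq Z'\}$. The products are Cartesian products. -}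

module Defs where

open import Level using (0ℓ)
open import Data.Nat using (ℕ; suc; _∸_; _≤_)
open import Data.Bool using (Bool; true)
open import Data.Fin.Subset using (Subset; ∣_∣; _∩_; _⊆_)
open import Data.Product using (Σ; _×_; _,_; proj₁; proj₂)
open import Data.List using (List; []; _∷_; _++_; [_]; length)
open import Data.List.Relation.Unary.Unique.Propositional using (Unique)
open import Data.Unit using (⊤)
open import Relation.Nullary using (¬_)
open import Relation.Binary using (Setoid)
open import Relation.Binary.PropositionalEquality as P using (_≡_)

B : ℕ → ℕ → Set
B n k = Σ (Subset n) (λ X → ∣ X ∣ ≡ k)

-- Johnson graph C(n,k): vertex set B n k, X ~ Y iff |X ∩ Y| = k - 1.
-- (Written as suc |X ∩ Y| ≡ k to avoid truncated subtraction; for k ≥ 1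
-- this is literally |X ∩ Y| = k - 1, and for k = 0 there are no edges.)
JAdj : (n k : ℕ) → B n k → B n k → Set
JAdj n k X Y = suc ∣ proj₁ X ∩ proj₁ Y ∣ ≡ k

-- Graph-theoretic notions for a graph with vertex type V and adjacency
-- relation Adj.  A set of edges is a Bool-valued symmetric relation E.

module _ {V : Set} where

  data Walk (E : V → V → Bool) : V → V → Set where
    here : ∀ {x} → Walk E x x
    step : ∀ {x y z} → E x y ≡ true → Walk E y z → Walk E x z

  Connected : (V → V → Bool) → Set
  Connected E = ∀ x y → Walk E x y

  EdgeChain : (V → V → Bool) → List V → Set
  EdgeChain E [] = ⊤
  EdgeChain E (x ∷ []) = ⊤
  EdgeChain E (x ∷ y ∷ vs) = (E x y ≡ true) × EdgeChain E (y ∷ vs)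

  IsCycle : (V → V → Bool) → V → List V → Set
  IsCycle E x vs = (2 ≤ length vs) × Unique (x ∷ vs) × EdgeChain E (x ∷ vs ++ [ x ])

  Acyclic : (V → V → Bool) → Set
  Acyclic E = ∀ x vs → ¬ IsCycle E x vs

  IsSpanningTree : (V → V → Set) → (V → V → Bool) → Set
  IsSpanningTree Adj E =
    (∀ x y → E x y ≡ E y x) × (∀ x y → E x y ≡ true → Adj x y) ×
    Connected E × Acyclic E

  RootedSpanningTree : (V → V → Set) → Set
  RootedSpanningTree Adj =
    Σ ((V → V → Bool) × V) (λ t → IsSpanningTree Adj (proj₁ t))

  RSTSetoid : (V → V → Set) → Setoid 0ℓ 0ℓ
  RSTSetoid Adj = record
    { Carrier = RootedSpanningTree Adj
    ; _≈_ = λ s t → (∀ x y → proj₁ (proj₁ s) x y ≡ proj₁ (proj₁ t) x y) ×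
                    (proj₂ (proj₁ s) ≡ proj₂ (proj₁ t))
    ; isEquivalence = record
      { refl = (λ _ _ → P.refl) , P.refl
      ; sym = λ (e , r) → (λ x y → P.sym (e x y)) , P.sym r
      ; trans = λ (e , r) (e' , r') → (λ x y → P.trans (e x y) (e' x y)) , P.trans r r'
      }
    }

T : ℕ → ℕ → Setoid 0ℓ 0ℓ
T n k = RSTSetoid {B n k} (JAdj n k)

UD : (n k : ℕ) → B n k → Set
UD n k X = Σ (B n (k ∸ 1) × B n k)
  (λ p → (proj₁ (proj₁ p) ⊆ proj₁ X) × (proj₁ (proj₁ p) ⊆ proj₁ (proj₂ p)))

DU : (n k : ℕ) → B n (k ∸ 1) → Set
DU n k X = Σ (B n k × B n (k ∸ 1))
  (λ p → (proj₁ X ⊆ proj₁ (proj₁ p)) × (proj₁ (proj₂ p) ⊆ proj₁ (proj₁ p)))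

-- Cartesian product ∏_{X ∈ I} S(X) of subsets S(X) of a fixed set D:
-- choice functions, equal iff pointwise equal as elements of D.
ΠSetoid : (I : Set) {D : Set} (S : I → Set) (emb : ∀ {i} → S i → D) → Setoid 0ℓ 0ℓ
ΠSetoid I S emb = record
  { Carrier = (i : I) → S i
  ; _≈_ = λ f g → ∀ i → emb (f i) ≡ emb (g i)
  ; isEquivalence = record
    { refl = λ _ → P.refl
    ; sym = λ e i → P.sym (e i)
    ; trans = λ e e' i → P.trans (e i) (e' i)
    }
  }

∏DU : (n m : ℕ) → Setoid 0ℓ 0ℓ
∏DU n m = ΠSetoid (B n (m ∸ 1)) (DU n m) proj₁

∏UD : (n m : ℕ) → Setoid 0ℓ 0ℓ
∏UD n m = ΠSetoid (B n m) (UD n m) proj₁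

{-# OPTIONS --safe #-}

-- Write P, Q for the levels m and m − 1.  Every X ∈ P has a = m subsets in Q and every Y ∈ Q has
-- b = n − m + 1 supersets in P.  A pair (Y, Z) ∈ UD(X) with Z ≠ X is the same as a neighbour Z of X,
-- because then Y = X ∩ Z; dually for DU.  Hence a rooted spanning tree of C(n,m), together with one
-- element of UD(root), is a choice function k ∈ ∏ UD(X) with a root r reached from everywhere under
-- X ↦ Z.  Likewise for C(n,m-1) and DU.  Two bijections then connect the two sides:
--
-- * Merging.  Let every X choose Y = g(X) and then Z ⊇ Y, either by a choice β(X) of its own or by
--   the choice h(Y) shared by all X with g(X) = Y.  The pairs (β, h) for which r is reached from
--   everywhere are equinumerous in both regimes.  Points switch regime one at a time: if i joins
--   the points already using h(g(i)), exchange β(i) and h(g(i)) whenever one of them leads to i before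
--   meeting r or one of those points.
--
-- * Rotation.  Once both levels move by single choices, G : P → Q and H : Q → P, a root r ∈ P of H ∘ G
--   corresponds to the root G(r) ∈ Q of G ∘ H.
--
-- This yields the claim up to a factor ab on both sides, which is cancelled since all sets are finite.
module Submission where

open import Defs
open import Data.Bool using (Bool; true; false; if_then_else_; _∨_)
open import Data.Bool.Properties using () renaming (_≟_ to _≟ᵇ_)
open import Data.Empty using (⊥-elim)
open import Data.Fin using (Fin; zero; suc; toℕ; combine; funToFin; finToFun; cast)
open import Data.Fin.Permutation using (↔⇒≡)
open import Data.Fin.Properties using (suc-injective; *↔×; funToFin-finToFin; finToFun-funToFin; pigeonhole; all?; _≟_; toℕ≤pred[n]; cast-involutive)
open import Data.Fin.Subset using (Subset; inside; outside; ∣_∣; _∩_; _∪_; _⊆_; ∁)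
open import Data.Fin.Subset.Properties using (drop-∷-⊆; out⊆; s⊆s; ⊆-refl; p⊆q⇒∣p∣≤∣q∣; ∣∁p∣≡n∸∣p∣; p∩q⊆p; p∩q⊆q; x∈p∩q⁺; x∈p∪q⁻; p⊆p∪q; q⊆p∪q; ∩-comm; ∩-idem)
open import Data.List using (List; []; _∷_; map; allFin; _++_; [_]; length)
open import Data.List.Membership.DecPropositional using () renaming (_∈?_ to memb?)
open import Data.List.Membership.Propositional using (_∈_)
open import Data.List.Membership.Propositional.Properties using (∈-map⁺; ∈-allFin)
open import Data.List.Relation.Unary.All as All using (All; []; _∷_)
open import Data.List.Relation.Unary.All.Properties using (¬Any⇒All¬)
open import Data.List.Relation.Unary.AllPairs using ([]; _∷_)
open import Data.List.Relation.Unary.Any using (here; there)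
open import Data.List.Relation.Unary.Unique.Propositional using (Unique)
open import Data.Nat using (ℕ; zero; suc; _+_; _*_; _∸_; _^_; _≤_; _<_; z≤n; s≤s)
open import Data.Nat.Properties using (≤-trans; ≤-refl; <-trans; <-irrefl; *-cancelʳ-≡; ∸-cancelˡ-≡; <⇒≢; <⇒≤; *-comm; ≤-antisym; ≤∧≢⇒<; +-suc; +-cancelˡ-≡; +-cancelʳ-≡; +-∸-assoc; n≮n; ≡-irrelevant; m<1+n⇒m≤n; m≤m+n) renaming (_≟_ to _≟ℕ_; suc-injective to ℕ-suc-injective)
open import Data.Product using (Σ; ∃; ∃₂; _×_; _,_; proj₁; proj₂; swap)
open import Data.Product.Function.NonDependent.Setoid using (_×-inverse_)
open import Data.Product.Properties using (,-injective)
open import Data.Product.Relation.Binary.Pointwise.NonDependent using (×-setoid; ≡×≡⇒≡)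
open import Data.Sum as Sum using (_⊎_; inj₁; inj₂; [_,_]′)
open import Data.Unit using (⊤; tt)
open import Data.Vec using ([]; _∷_; here)
open import Data.Vec.Properties using (≡-dec; ∷-injectiveʳ)
open import Function using (id; _∘_)
open import Function.Bundles using (Inverse; mk⇔)
import Function.Construct.Composition as Composition
import Function.Construct.Symmetry as Symmetry
open import Level using (0ℓ)
open import Relation.Binary using (Setoid; DecidableEquality)
import Relation.Binary.Construct.On as On
open import Relation.Binary.PropositionalEquality using (_≡_; _≢_; _≗_; refl; sym; trans; cong; cong₂; subst; setoid; _→-setoid_; module ≡-Reasoning)
open import Relation.Nullary using (¬_; Dec; yes; no; contradiction)
open import Relation.Nullary.Decidable using (map′; does; dec-true; dec-false; _⊎-dec_; _×-dec_; ¬?; does-⇔)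

open Setoid using (Carrier)

-- Bijections of setoids

_≅_ : Setoid 0ℓ 0ℓ → Setoid 0ℓ 0ℓ → Set
_≅_ = Inverse

infix 4 _≅_

≅-sym : ∀ {S S′} → S ≅ S′ → S′ ≅ S
≅-sym = Symmetry.inverse

infixr 5 _⟫_

_⟫_ : ∀ {S S′ S″} → S ≅ S′ → S′ ≅ S″ → S ≅ S″
_⟫_ = Composition.inverse

module _ {S S′ : Setoid 0ℓ 0ℓ} where

  private
    module S = Setoid S
    module S′ = Setoid S′

  mk≅ : (to : S.Carrier → S′.Carrier) (from : S′.Carrier → S.Carrier) →
        (∀ {x y} → x S.≈ y → to x S′.≈ to y) →
        (∀ {x y} → x S′.≈ y → from x S.≈ from y) →
        (∀ y → to (from y) S′.≈ y) → (∀ x → from (to x) S.≈ x) → S ≅ S′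
  mk≅ to from to-cong from-cong to∘from from∘to = record
    { to = to ; from = from ; to-cong = to-cong ; from-cong = from-cong
    ; inverse = (λ e → S′.trans (to-cong e) (to∘from _))
              , (λ e → S.trans (from-cong e) (from∘to _)) }

  -- The remaining laws follow by applying `to-inj` to `to∘from`. This spares a congruence proof for
  -- inverses that depend on chosen data, such as the parent choices read off a tree.
  mk≅-injective : (to : S.Carrier → S′.Carrier) (from : S′.Carrier → S.Carrier) →
        (∀ {x y} → x S.≈ y → to x S′.≈ to y) →
        (∀ {x y} → to x S′.≈ to y → x S.≈ y) →
        (∀ y → to (from y) S′.≈ y) → S ≅ S′
  mk≅-injective to from to-cong to-inj to∘from = mk≅ to from to-cong
    (λ e → to-inj (S′.trans (to∘from _) (S′.trans e (S′.sym (to∘from _)))))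
    to∘from (λ _ → to-inj (to∘from _))

-- Equality compares first components only, so several proofs of `W` do not affect the count.
Restrict : (S : Setoid 0ℓ 0ℓ) → (Carrier S → Set) → Setoid 0ℓ 0ℓ
Restrict S W = On.setoid {B = Σ (Carrier S) W} S proj₁

restrict-≅ : ∀ {S S′} {W : Carrier S → Set} {W′ : Carrier S′ → Set} (i : S ≅ S′) →
  (∀ s → W s → W′ (Inverse.to i s)) → (∀ s → W′ s → W (Inverse.from i s)) →
  Restrict S W ≅ Restrict S′ W′
restrict-≅ i f g = mk≅
  (λ (s , w) → Inverse.to i s , f s w) (λ (s , w) → Inverse.from i s , g s w)
  (Inverse.to-cong i) (Inverse.from-cong i)
  (λ (s , _) → Inverse.strictlyInverseˡ i s) (λ (s , _) → Inverse.strictlyInverseʳ i s)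

≅-id : ∀ {S} → S ≅ S
≅-id {S} = mk≅ id id id id (λ _ → Setoid.refl S) (λ _ → Setoid.refl S)

×-exchange : ∀ {S S′ S″} → ×-setoid (×-setoid S S′) S″ ≅ ×-setoid (×-setoid S S″) S′
×-exchange {S} {S′} {S″} = mk≅
  (λ ((x , y) , z) → ((x , z) , y)) (λ ((x , z) , y) → ((x , y) , z))
  (λ ((x , y) , z) → ((x , z) , y)) (λ ((x , z) , y) → ((x , y) , z))
  (λ _ → (Setoid.refl S , Setoid.refl S″) , Setoid.refl S′)
  (λ _ → (Setoid.refl S , Setoid.refl S′) , Setoid.refl S″)

-- Finite setoids

Card : Setoid 0ℓ 0ℓ → ℕ → Set
Card S N = S ≅ setoid (Fin N)

Finite : Setoid 0ℓ 0ℓ → Set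
Finite S = ∃ (Card S)

card-unique : ∀ {S M N} → Card S M → Card S N → M ≡ N
card-unique c c′ = ↔⇒≡ (≅-sym c ⟫ c′)

×-card : ∀ {S S′ M N} → Card S M → Card S′ N → Card (×-setoid S S′) (M * N)
×-card {M = M} {N} c c′ = (c ×-inverse c′) ⟫ pairs ⟫ ≅-sym (*↔× {M} {N})
  where
  pairs : ×-setoid (setoid (Fin M)) (setoid (Fin N)) ≅ setoid (Fin M × Fin N)
  pairs = mk≅ id id ≡×≡⇒≡ (λ { refl → refl , refl }) (λ _ → refl) (λ _ → refl , refl)

×-finite : ∀ {S S′} → Finite S → Finite S′ → Finite (×-setoid S S′)
×-finite (_ , c) (_ , c′) = _ , ×-card c c′

funToFin-cong : ∀ {m n} {f g : Fin m → Fin n} → f ≗ g → funToFin f ≡ funToFin g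
funToFin-cong {zero} _ = refl
funToFin-cong {suc m} e = cong₂ combine (e zero) (funToFin-cong (e ∘ suc))

→-finite : ∀ {I D : Set} → Finite (setoid I) → Finite (setoid D) → Finite (I →-setoid D)
→-finite {I} {D} (M , i) (N , d) = N ^ M , mk≅
  (λ f → funToFin (λ x → d.to (f (i.from x)))) (λ k x → d.from (finToFun k (i.to x)))
  (λ e → funToFin-cong (λ x → cong d.to (e (i.from x))))
  (λ { refl _ → refl })
  (λ k → trans (funToFin-cong (λ x → trans (d.strictlyInverseˡ _)
                 (cong (finToFun k) (i.strictlyInverseˡ x))))
               (funToFin-finToFin {M} {N} k))
  (λ f x → trans (cong d.from (finToFun-funToFin _ (i.to x)))
             (trans (d.strictlyInverseʳ _) (cong f (i.strictlyInverseʳ x))))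
  where
  module i = Inverse i
  module d = Inverse d

Fin-restrict-finite : ∀ {N} {W : Fin N → Set} → (∀ i → Dec (W i)) → Finite (Restrict (setoid (Fin N)) W)
Fin-restrict-finite {zero} W? = 0 , mk≅ proj₁ (λ ()) id (λ { {()} }) (λ ()) (λ { (() , _) })
Fin-restrict-finite {suc N} {W} W? with Fin-restrict-finite (W? ∘ suc) | W? zero
... | M , c | yes w = suc M , mk≅ to from (λ {x} {y} → to-cong {x} {y}) (λ { refl → refl }) to∘from from∘to
  where
  module c = Inverse c
  to : Σ (Fin (suc N)) W → Fin (suc M)
  to (zero , _) = zero
  to (suc i , w′) = suc (c.to (i , w′))
  from : Fin (suc M) → Σ (Fin (suc N)) W
  from zero = zero , w
  from (suc j) = suc (proj₁ (c.from j)) , proj₂ (c.from j)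
  to-cong : ∀ {x y} → proj₁ x ≡ proj₁ y → to x ≡ to y
  to-cong {zero , _} {zero , _} _ = refl
  to-cong {suc _ , _} {suc _ , _} e = cong suc (c.to-cong (suc-injective e))
  to∘from : ∀ j → to (from j) ≡ j
  to∘from zero = refl
  to∘from (suc j) = cong suc (c.strictlyInverseˡ j)
  from∘to : ∀ x → proj₁ (from (to x)) ≡ proj₁ x
  from∘to (zero , _) = refl
  from∘to (suc i , w′) = cong suc (c.strictlyInverseʳ (i , w′))
... | M , c | no ¬w = M , mk≅ to from (λ {x} {y} → to-cong {x} {y}) (λ { refl → refl }) c.strictlyInverseˡ from∘to
  where
  module c = Inverse c
  to : Σ (Fin (suc N)) W → Fin M
  to (zero , w) = contradiction w ¬w
  to (suc i , w) = c.to (i , w)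
  from : Fin M → Σ (Fin (suc N)) W
  from j = suc (proj₁ (c.from j)) , proj₂ (c.from j)
  to-cong : ∀ {x y} → proj₁ x ≡ proj₁ y → to x ≡ to y
  to-cong {zero , w} _ = contradiction w ¬w
  to-cong {suc _ , _} {suc _ , _} e = c.to-cong (suc-injective e)
  from∘to : ∀ x → proj₁ (from (to x)) ≡ proj₁ x
  from∘to (zero , w) = contradiction w ¬w
  from∘to (suc i , w) = cong suc (c.strictlyInverseʳ (i , w))

restrict-finite : ∀ {S} {W : Carrier S → Set} → Finite S → (∀ s → Dec (W s)) →
  (∀ {s t} → Setoid._≈_ S s t → W s → W t) → Finite (Restrict S W)
restrict-finite {S} {W} (N , c) W? W-resp = proj₁ r , (i ⟫ proj₂ r)
  where
  module c = Inverse c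
  r : Finite (Restrict (setoid (Fin N)) (W ∘ c.from))
  r = Fin-restrict-finite (W? ∘ c.from)
  i : Restrict S W ≅ Restrict (setoid (Fin N)) (W ∘ c.from)
  i = restrict-≅ c (λ s → W-resp (Setoid.sym S (c.strictlyInverseʳ s))) (λ _ → id)

∀? : ∀ {V : Set} {W : V → Set} → Finite (setoid V) → (∀ v → Dec (W v)) → Dec (∀ v → W v)
∀? {W = W} (N , c) W? = map′ (λ h v → subst W (c.strictlyInverseʳ v) (h (c.to v)))
  (λ h i → h (c.from i)) (all? (W? ∘ c.from))
  where module c = Inverse c

-- `S` is the slice over `zero`, a decidable part of a finite setoid. Trees are shown to be finite
-- in this way, without being enumerated.
×-factor-finite : ∀ {S S′ N} → Finite (×-setoid S S′) → Card S′ (suc N) → Finite S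
×-factor-finite {S} {S′} {N} f k = proj₁ r , (i ⟫ proj₂ r)
  where
  module k = Inverse k
  f′ : Finite (×-setoid S (setoid (Fin (suc N))))
  f′ = proj₁ f , (≅-sym (≅-id ×-inverse k) ⟫ proj₂ f)
  r : Finite (Restrict (×-setoid S (setoid (Fin (suc N)))) (λ z → proj₂ z ≡ zero))
  r = restrict-finite f′ (λ z → proj₂ z ≟ zero) (λ e p → trans (sym (proj₂ e)) p)
  i : S ≅ Restrict (×-setoid S (setoid (Fin (suc N)))) (λ z → proj₂ z ≡ zero)
  i = mk≅ (λ s → (s , zero) , refl) (λ z → proj₁ (proj₁ z)) (λ e → e , refl) proj₁
    (λ ((s , _) , e) → Setoid.refl S , sym e) (λ _ → Setoid.refl S)

-- A counting argument: the cardinalities M and M′ of `S` and `S′` satisfy M(N + 1) = M′(N + 1). The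
-- bijection obtained composes two enumerations.
×-cancel : ∀ {S S′ D D′ N} → Finite (×-setoid S D) → Card D (suc N) → Card D′ (suc N) →
  ×-setoid S D ≅ ×-setoid S′ D′ → S ≅ S′
×-cancel {S} {S′} {D} {D′} {N} f d d′ i
  with ×-factor-finite f d | ×-factor-finite {S′} (proj₁ f , (≅-sym i ⟫ proj₂ f)) d′
... | M , c | M′ , c′
  with *-cancelʳ-≡ M M′ (suc N) (card-unique (×-card c d) (i ⟫ ×-card c′ d′))
... | refl = c ⟫ ≅-sym c′

-- Iteration of a map

module _ {V : Set} where

  iterate : (V → V) → ℕ → V → V
  iterate f zero x = x
  iterate f (suc n) x = iterate f n (f x)

  Reaches : (V → V) → V → V → Set
  Reaches f r x = ∃ λ n → iterate f n x ≡ r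

  reaches-step : ∀ {f r x} → Reaches f r (f x) → Reaches f r x
  reaches-step (n , e) = suc n , e

  reaches-≗ : ∀ {f g r x} → f ≗ g → Reaches f r x → Reaches g r x
  reaches-≗ {f} {g} {r} e (n , p) = n , trans (sym (iterate-≗ n _)) p
    where
    iterate-≗ : ∀ n x → iterate f n x ≡ iterate g n x
    iterate-≗ zero x = refl
    iterate-≗ (suc n) x = trans (cong (iterate f n) (e x)) (iterate-≗ n (g x))

  -- The orbit of x first meets S after n steps, at t.
  data Hit (f : V → V) (S : V → Set) : ℕ → V → V → Set where
    stop : ∀ {t} → S t → Hit f S 0 t t
    step : ∀ {n x t} → ¬ S x → Hit f S n (f x) t → Hit f S (suc n) x t

  module _ {f : V → V} {S : V → Set} where

    hit-∈ : ∀ {n x t} → Hit f S n x t → S t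
    hit-∈ (stop s) = s
    hit-∈ (step _ h) = hit-∈ h

    hit-unique : ∀ {n n′ x t t′} → Hit f S n x t → Hit f S n′ x t′ → n ≡ n′ × t ≡ t′
    hit-unique (stop s) (stop _) = refl , refl
    hit-unique (stop s) (step ¬s _) = contradiction s ¬s
    hit-unique (step ¬s _) (stop s) = contradiction s ¬s
    hit-unique (step _ h) (step _ h′) with hit-unique h h′
    ... | refl , e = refl , e

    hit-iterate : ∀ {n x t} → Hit f S n x t → iterate f n x ≡ t
    hit-iterate (stop _) = refl
    hit-iterate (step _ h) = hit-iterate h

    -- Until it stops, the orbit sees only points outside `S`, so agreement of the maps there
    -- suffices.
    hit-map : ∀ {f′ S′ n x t} → (∀ {v} → S v → S′ v) → (∀ {v} → S′ v → S v) →
      (∀ {v} → ¬ S v → f v ≡ f′ v) → Hit f S n x t → Hit f′ S′ n x t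
    hit-map i j e (stop s) = stop (i s)
    hit-map {f′} {S′} {suc n} {_} {t} i j e (step ¬s h) =
      step (¬s ∘ j) (subst (λ v → Hit f′ S′ n v t) (e ¬s) (hit-map i j e h))

    hit-suffix : ∀ {n x t} k → k ≤ n → Hit f S n x t → Hit f S (n ∸ k) (iterate f k x) t
    hit-suffix zero _ h = h
    hit-suffix (suc k) (s≤s k≤n) (step _ h) = hit-suffix k k≤n h

    hit-reaches : ∀ {n x t r} → Hit f S n x t → Reaches f r t → Reaches f r x
    hit-reaches (stop _) p = p
    hit-reaches (step _ h) p = reaches-step (hit-reaches h p)

    reaches-hit : (∀ v → Dec (S v)) → ∀ {x r} → S r → Reaches f r x → ∃₂ λ n t → Hit f S n x t
    reaches-hit S? {x} {r} s (n , e) = go n x e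
      where
      go : ∀ n x → iterate f n x ≡ r → ∃₂ λ n t → Hit f S n x t
      go n x e with S? x
      go n x e | yes s′ = 0 , x , stop s′
      go zero x refl | no ¬s = contradiction s ¬s
      go (suc n) x e | no ¬s with go n (f x) e
      ... | n′ , t , h = suc n′ , t , step ¬s h

    -- Within a hitting orbit all points are distinct, so the number of steps
    -- is bounded by the number of points.
    hit? : Finite (setoid V) → (∀ v → Dec (S v)) → ∀ x → Dec (∃₂ λ n t → Hit f S n x t)
    hit? (N , c) S? x = [ yes , (λ b → no (λ (n , t , h) → bound h (b h))) ]′ (search N x)
      where
      search : ∀ k x → (∃₂ λ n t → Hit f S n x t) ⊎ (∀ {n t} → Hit f S n x t → k ≤ n)
      search zero x = inj₂ (λ _ → z≤n)
      search (suc k) x with S? x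
      ... | yes s = inj₁ (0 , x , stop s)
      ... | no ¬s with search k (f x)
      ... | inj₁ (n , t , h) = inj₁ (suc n , t , step ¬s h)
      ... | inj₂ b = inj₂ (λ { (stop s) → contradiction s ¬s ; (step _ h) → s≤s (b h) })
      bound : ∀ {n x t} → Hit f S n x t → ¬ N ≤ n
      bound {n} {x} {t} h N≤n with pigeonhole (≤-refl {suc N}) (λ i → Inverse.to c (iterate f (toℕ i) x))
      -- Equal iterates at `i < j` would first meet `S` after both `n ∸ i` and `n ∸ j` steps.
      ... | i , j , i<j , e = <⇒≢ i<j (∸-cancelˡ-≡ (at i) (at j) (proj₁ (hit-unique
              (hit-suffix (toℕ i) (at i) h)
              (subst (λ v → Hit f S (n ∸ toℕ j) v t) (sym e′) (hit-suffix (toℕ j) (at j) h)))))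
        where
        at : (i : Fin (suc N)) → toℕ i ≤ n
        at i = ≤-trans (toℕ≤pred[n] i) N≤n
        e′ : iterate f (toℕ i) x ≡ iterate f (toℕ j) x
        e′ = trans (sym (Inverse.strictlyInverseʳ c _)) (trans (cong (Inverse.from c) e) (Inverse.strictlyInverseʳ c _))

  reaches? : Finite (setoid V) → (∀ x y → Dec (x ≡ y)) → ∀ f r x → Dec (Reaches f r x)
  reaches? fin _≟_ f r x = map′
    (λ (n , t , h) → n , trans (hit-iterate h) (hit-∈ h))
    (reaches-hit (λ v → v ≟ r) refl)
    (hit? {f} {λ v → v ≡ r} fin (λ v → v ≟ r) x)

-- The rank of `v` is its number of steps to `r`. It drops at every step off the root and so
-- excludes cycles that avoid `r`.
module Rank {V : Set} (_≟_ : DecidableEquality V) (f : V → V) (r : V)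
            (rooted : ∀ v → Reaches f r v) where

  private
    ranked : ∀ v → ∃₂ λ n t → Hit f (_≡ r) n v t
    ranked v = reaches-hit (_≟ r) refl (rooted v)

  rank : V → ℕ
  rank v = proj₁ (ranked v)

  hit-root : ∀ v → Hit f (_≡ r) (rank v) v r
  hit-root v with ranked v
  ... | n , t , h with hit-∈ h
  ... | refl = h

  rank-step : ∀ {v} → v ≢ r → rank v ≡ suc (rank (f v))
  rank-step v≢r = proj₁ (hit-unique (hit-root _) (step v≢r (hit-root _)))

  rank-decreases : ∀ {v} → v ≢ r → rank (f v) < rank v
  rank-decreases v≢r = subst (rank (f _) <_) (sym (rank-step v≢r)) ≤-refl

-- Merging choices

-- The setting for switching `i`: `Cl` holds the points already using the choice that `i` is to
-- share. All maps compared agree with `f₀` off `Stop`, so `Leads`, the first stop on an orbit,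
-- means the same for all of them.
module Fuse {V : Set} (_≟_ : DecidableEquality V) (r i : V) (Cl : V → Set) (f₀ : V → V) where

  Stop : V → Set
  Stop v = v ≡ r ⊎ v ≡ i ⊎ Cl v

  Leads : V → V → Set
  Leads t v = ∃ λ n → Hit f₀ Stop n v t

  Agrees : (V → V) → Set
  Agrees f = ∀ {v} → ¬ Stop v → f₀ v ≡ f v

  leads-reaches : ∀ {f t v} → Agrees f → Leads t v → Reaches f r t → Reaches f r v
  leads-reaches ag (n , h) = hit-reaches (hit-map id id ag h)

  stop? : (∀ v → Dec (Cl v)) → ∀ v → Dec (Stop v)
  stop? Cl? v = (v ≟ r) ⊎-dec ((v ≟ i) ⊎-dec Cl? v)

  leads? : Finite (setoid V) → (∀ v → Dec (Cl v)) → ∀ t v → Dec (Leads t v)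
  leads? fin Cl? t v with hit? {f = f₀} fin (stop? Cl?) v
  ... | no ¬h = no (λ (n , h) → ¬h (n , t , h))
  ... | yes (n , t′ , h) with t′ ≟ t
  ... | yes refl = yes (n , h)
  ... | no ≢ = no (λ (_ , h′) → ≢ (proj₂ (hit-unique h h′)))

  module _ (Cl? : ∀ v → Dec (Cl v)) where

    private
      module Rooted {f : V → V} (ag : Agrees f) (rooted : ∀ v → Reaches f r v) where

        open Rank _≟_ f r rooted

        leads-somewhere : ∀ v → ∃ λ t → Leads t v
        leads-somewhere v with reaches-hit (stop? Cl?) (inj₁ refl) (rooted v)
        ... | n , t , h = t , n , hit-map id id (λ ¬s → sym (ag ¬s)) h

        rank-mono : ∀ {n v t} → Hit f₀ Stop n v t → rank t ≤ rank v
        rank-mono (stop _) = ≤-refl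
        rank-mono (step ¬s h) = ≤-trans (rank-mono h)
          (subst (λ w → rank w ≤ _) (sym (ag ¬s)) (<⇒≤ (rank-decreases (¬s ∘ inj₁))))

        -- The orbit from `v` to its next stop follows `f` and hence lowers the rank. Cycles through
        -- stops other than `r` are thereby impossible.
        descend : ∀ {v t} → v ≢ r → Leads t (f v) → rank t < rank v
        descend v≢r (_ , h) = ≤-trans (s≤s (rank-mono h)) (rank-decreases v≢r)

        no-return : ∀ {v} → v ≢ r → ¬ Leads v (f v)
        no-return v≢r l = <-irrefl refl (descend v≢r l)

        no-2-cycle : ∀ {v w} → v ≢ r → w ≢ r → Leads w (f v) → ¬ Leads v (f w)
        no-2-cycle v≢r w≢r l l′ = <-irrefl refl (<-trans (descend v≢r l) (descend w≢r l′))

      -- Cut each orbit at its first stop: at `r` it is finished, and the other stops are covered by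
      -- the last two hypotheses.
      rooted-if : ∀ {f} → Agrees f → (∀ v → ∃ λ t → Leads t v) →
        Reaches f r (f i) → (∀ {v} → Cl v → Reaches f r (f v)) → ∀ v → Reaches f r v
      rooted-if ag all at-i at-Cl v with all v
      ... | t , l with hit-∈ (proj₂ l)
      ... | inj₁ refl = leads-reaches ag l (0 , refl)
      ... | inj₂ (inj₁ refl) = leads-reaches ag l (reaches-step at-i)
      ... | inj₂ (inj₂ c) = leads-reaches ag l (reaches-step (at-Cl c))

    -- Before the switch (`f`) the class moves to `a` and `i` to `b`; after it (`f′`) all of them
    -- move to `a′`. As every orbit meets a stop, `f′` is rooted once `a′` leads to `r`, so the task
    -- is to say which of `a` and `b` does.
    module Fusion {f f′ : V → V} {a b a′ : V} (ag : Agrees f) (ag′ : Agrees f′) (i≢r : i ≢ r)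
             (f-Cl : ∀ {v} → Cl v → f v ≡ a) (f-i : f i ≡ b)
             (f′-Cl : ∀ {v} → Cl v → f′ v ≡ a′) (f′-i : f′ i ≡ a′) where

      module _ (rooted : ∀ v → Reaches f r v) where

        open Rooted ag rooted

        private
          rooted′ : Leads r a′ → ∀ v → Reaches f′ r v
          rooted′ l = rooted-if ag′ leads-somewhere
            (subst (Reaches f′ r) (sym f′-i) ok) (λ c → subst (Reaches f′ r) (sym (f′-Cl c)) ok)
            where
            ok : Reaches f′ r a′
            ok = leads-reaches ag′ l (0 , refl)

        ¬b-leads-i : ¬ Leads i b
        ¬b-leads-i l = no-return i≢r (subst (Leads i) (sym f-i) l)

        -- The class moves via `a` to `i` and then to `b`. If `b` led to `i` or to the class, a
        -- cycle would close, so its first stop is `r`.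
        fuse-swap : Leads i a → a′ ≡ b → ∀ v → Reaches f′ r v
        fuse-swap a⇝i refl with leads-somewhere b
        ... | t , l with t ≟ r | hit-∈ (proj₂ l)
        ... | yes refl | _ = rooted′ l
        ... | no t≢r | inj₁ t≡r = contradiction t≡r t≢r
        ... | no t≢r | inj₂ (inj₁ refl) = contradiction l ¬b-leads-i
        ... | no t≢r | inj₂ (inj₂ c) = ⊥-elim (no-2-cycle t≢r i≢r
                (subst (Leads i) (sym (f-Cl c)) a⇝i) (subst (Leads t) (sym f-i) l))

        -- Here `a` does not lead to `i`, and leading back to the class would close a cycle; so it
        -- leads to `r`.
        fuse-keep : ¬ Leads i a → a′ ≡ a → ∀ v → Reaches f′ r v
        fuse-keep ¬a⇝i refl with leads-somewhere a
        ... | t , l with t ≟ r | hit-∈ (proj₂ l)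
        ... | yes refl | _ = rooted′ l
        ... | no t≢r | inj₁ t≡r = contradiction t≡r t≢r
        ... | no t≢r | inj₂ (inj₁ refl) = contradiction l ¬a⇝i
        ... | no t≢r | inj₂ (inj₂ c) = ⊥-elim (no-return t≢r (subst (Leads t) (sym (f-Cl c)) l))

      module _ (rooted : ∀ v → Reaches f′ r v) where

        open Rooted ag′ rooted

        ¬a′-leads-i : ¬ Leads i a′
        ¬a′-leads-i l = no-return i≢r (subst (Leads i) (sym f′-i) l)

        private
          a′-leads-r : Leads r a′
          a′-leads-r with leads-somewhere a′
          ... | t , l with t ≟ r | hit-∈ (proj₂ l)
          ... | yes refl | _ = l
          ... | no t≢r | inj₁ t≡r = contradiction t≡r t≢r
          ... | no t≢r | inj₂ (inj₁ refl) = contradiction l ¬a′-leads-i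
          ... | no t≢r | inj₂ (inj₂ c) = ⊥-elim (no-return t≢r (subst (Leads t) (sym (f′-Cl c)) l))

          ok : Reaches f r a′
          ok = leads-reaches ag a′-leads-r (0 , refl)

        -- Now `a′` leads to `r`. The point `i` follows it, and the class goes through `a` to `i`.
        split-swap : Leads i a → b ≡ a′ → ∀ v → Reaches f r v
        split-swap a⇝i refl = rooted-if ag leads-somewhere at-i
          (λ c → subst (Reaches f r) (sym (f-Cl c)) (leads-reaches ag a⇝i (reaches-step at-i)))
          where
          at-i : Reaches f r (f i)
          at-i = subst (Reaches f r) (sym f-i) ok

        -- The class follows `a′` to `r`, while `b` leads to `r` directly or by way of the class.
        split-keep : ¬ Leads i b → a ≡ a′ → ∀ v → Reaches f r v
        split-keep ¬b⇝i refl = rooted-if ag leads-somewhere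
          (subst (Reaches f r) (sym f-i) b-ok) at-Cl
          where
          at-Cl : ∀ {v} → Cl v → Reaches f r (f v)
          at-Cl c = subst (Reaches f r) (sym (f-Cl c)) ok
          b-ok : Reaches f r b
          b-ok with leads-somewhere b
          ... | t , l with hit-∈ (proj₂ l)
          ... | inj₁ refl = leads-reaches ag l (0 , refl)
          ... | inj₂ (inj₁ refl) = contradiction l ¬b⇝i
          ... | inj₂ (inj₂ c) = leads-reaches ag l (reaches-step (at-Cl c))

-- Switching the points of P one by one

update : ∀ {I D : Set} → DecidableEquality I → (I → D) → I → D → I → D
update _≟_ f i d j = if does (j ≟ i) then d else f j

module _ {I D : Set} (_≟_ : DecidableEquality I) (f : I → D) {i : I} {d : D} where

  update-at : ∀ {j} → j ≡ i → update _≟_ f i d j ≡ d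
  update-at {j} j≡i rewrite dec-true (j ≟ i) j≡i = refl

  update-off : ∀ {j} → j ≢ i → update _≟_ f i d j ≡ f j
  update-off {j} j≢i rewrite dec-false (j ≟ i) j≢i = refl

-- `E` is the part of a state that merging leaves untouched; it determines the first step `g`.
module Merge {P Q D : Set} (finP : Finite (setoid P))
             (_≟P_ : DecidableEquality P) (_≟Q_ : DecidableEquality Q) (e : Q → D → P)
             (E : Setoid 0ℓ 0ℓ) (g : Carrier E → P → Q)
             (g-cong : ∀ {x y} → Setoid._≈_ E x y → g x ≗ g y) where

  State : Setoid 0ℓ 0ℓ
  State = ×-setoid (×-setoid E (×-setoid (P →-setoid D) (Q →-setoid D))) (setoid P)

  private
    module St = Setoid State

  -- U marks the points of P that take their choice from their image in Q.
  move : (P → Bool) → St.Carrier → P → P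
  move U ((x , β , h) , _) p = e (g x p) (if U p then h (g x p) else β p)

  Rooted : (P → Bool) → St.Carrier → Set
  Rooted U s = ∀ p → Reaches (move U s) (proj₂ s) p

  mark : P → (P → Bool) → P → Bool
  mark i U p = does (p ≟P i) ∨ U p

  private
    module Flip (U : P → Bool) (i : P) (Ui : U i ≡ false) where

      Class : St.Carrier → P → Set
      Class ((x , _) , _) p = U p ≡ true × g x p ≡ g x i

      class? : ∀ s p → Dec (Class s p)
      class? ((x , _) , _) p = (U p ≟ᵇ true) ×-dec (g x p ≟Q g x i)

      module F (s : St.Carrier) = Fuse _≟P_ (proj₂ s) i (Class s) (move U s)

      shared own : St.Carrier → D
      shared ((x , β , h) , _) = h (g x i)
      own ((x , β , h) , _) = β i

      Leads : St.Carrier → D → Set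
      Leads s d = F.Leads s i (e (g (proj₁ (proj₁ s)) i) d)

      -- The condition is symmetric in the two choices, so it survives their exchange and one
      -- involution serves both directions. Nothing is exchanged when `i` is the root, since orbits
      -- have arrived before its move is made.
      Swaps : St.Carrier → Set
      Swaps s = i ≢ proj₂ s × (Leads s (shared s) ⊎ Leads s (own s))

      abstract
        swaps? : ∀ s → Dec (Swaps s)
        swaps? s = ¬? (i ≟P proj₂ s) ×-dec (F.leads? s finP (class? s) i _ ⊎-dec F.leads? s finP (class? s) i _)

      exchange : St.Carrier → St.Carrier
      exchange s@((x , β , h) , r) = (x , update _≟P_ β i (shared s) , update _≟Q_ h (g x i) (own s)) , r

      leads-map : ∀ s s′ {d d′} → proj₂ s ≡ proj₂ s′ →
        (∀ p → g (proj₁ (proj₁ s)) p ≡ g (proj₁ (proj₁ s′)) p) →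
        (∀ {p} → ¬ F.Stop s p → move U s p ≡ move U s′ p) → d ≡ d′ → Leads s d → Leads s′ d′
      leads-map s s′ {d} refl ge me refl (n , l) = n ,
        subst (λ v → Hit (move U s′) (F.Stop s′) n v i) (cong (λ q → e q d) (ge i))
          (hit-map {f = move U s} {S = F.Stop s} {S′ = F.Stop s′}
          (λ { (inj₁ x) → inj₁ x ; (inj₂ (inj₁ x)) → inj₂ (inj₁ x)
             ; (inj₂ (inj₂ (u , x))) → inj₂ (inj₂ (u , trans (sym (ge _)) (trans x (ge i)))) })
          (λ { (inj₁ x) → inj₁ x ; (inj₂ (inj₁ x)) → inj₂ (inj₁ x)
             ; (inj₂ (inj₂ (u , x))) → inj₂ (inj₂ (u , trans (ge _) (trans x (sym (ge i))))) })
          me l)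

      move-cong : ∀ U {s s′} → s St.≈ s′ → move U s ≗ move U s′
      move-cong U {(x , β , h) , _} ((xe , βe , he) , re) p rewrite sym (g-cong xe p) with U p
      ... | true = cong (e (g x p)) (he _)
      ... | false = cong (e (g x p)) (βe p)

      swaps-cong : ∀ {s s′} → s St.≈ s′ → Swaps s → Swaps s′
      swaps-cong {s} {s′@((x′ , β′ , h′) , _)} eq@((xe , βe , he) , refl) (i≢r , l) = i≢r , go l
        where
        go : Leads s (shared s) ⊎ Leads s (own s) → Leads s′ (shared s′) ⊎ Leads s′ (own s′)
        go (inj₁ l) = inj₁ (leads-map s s′ refl (g-cong xe) (λ _ → move-cong U eq _)
                        (trans (he _) (cong h′ (g-cong xe i))) l)
        go (inj₂ l) = inj₂ (leads-map s s′ refl (g-cong xe) (λ _ → move-cong U eq _) (βe i) l)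

      -- The exchange alters `β` at `i` and `h` at `g x i`; under `U` only `i` and its class read
      -- these values.
      move-exchange : ∀ s {p} → ¬ F.Stop s p → move U s p ≡ move U (exchange s) p
      move-exchange s@((x , β , h) , r) {p} ¬s = cong (e (g x p)) (go (U p) refl)
        where
        go : ∀ b → U p ≡ b → (if b then h (g x p) else β p) ≡
             (if b then update _≟Q_ h (g x i) (own s) (g x p) else update _≟P_ β i (shared s) p)
        go true up = sym (update-off _≟Q_ h (λ q → ¬s (inj₂ (inj₂ (up , q)))))
        go false _ = sym (update-off _≟P_ β (λ q → ¬s (inj₂ (inj₁ q))))

      shared-exchange : ∀ s → shared (exchange s) ≡ own s
      shared-exchange ((x , β , h) , r) = update-at _≟Q_ h refl

      own-exchange : ∀ s → own (exchange s) ≡ shared s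
      own-exchange ((x , β , h) , r) = update-at _≟P_ β refl

      swaps-exchange : ∀ s → Swaps s → Swaps (exchange s)
      swaps-exchange s (i≢r , l) = i≢r , go l
        where
        go : Leads s (shared s) ⊎ Leads s (own s) →
             Leads (exchange s) (shared (exchange s)) ⊎ Leads (exchange s) (own (exchange s))
        go (inj₁ l) = inj₂ (leads-map s (exchange s) refl (λ _ → refl) (move-exchange s) (sym (own-exchange s)) l)
        go (inj₂ l) = inj₁ (leads-map s (exchange s) refl (λ _ → refl) (move-exchange s) (sym (shared-exchange s)) l)

      exchange-cong : ∀ {s s′} → s St.≈ s′ → exchange s St.≈ exchange s′
      exchange-cong {(x , β , h) , _} {(x′ , β′ , h′) , _} ((xe , βe , he) , re) = (xe , b , c) , re
        where
        b : update _≟P_ β i (h (g x i)) ≗ update _≟P_ β′ i (h′ (g x′ i))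
        b p with does (p ≟P i)
        ... | true = trans (he _) (cong h′ (g-cong xe i))
        ... | false = βe p
        c : update _≟Q_ h (g x i) (β i) ≗ update _≟Q_ h′ (g x′ i) (β′ i)
        c q rewrite g-cong xe i with does (q ≟Q g x′ i)
        ... | true = βe i
        ... | false = he q

      exchange-involutive : ∀ s → exchange (exchange s) St.≈ s
      exchange-involutive s@((x , β , h) , _) = (Setoid.refl E , b , c) , refl
        where
        b : ∀ p → proj₁ (proj₂ (proj₁ (exchange (exchange s)))) p ≡ β p
        b p with p ≟P i
        ... | yes refl = shared-exchange s
        ... | no _ = refl
        c : ∀ q → proj₂ (proj₂ (proj₁ (exchange (exchange s)))) q ≡ h q
        c q with q ≟Q g x i
        ... | yes refl = own-exchange s
        ... | no _ = refl

      apply : ∀ s → Dec (Swaps s) → St.Carrier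
      apply s (yes _) = exchange s
      apply s (no _) = s

      σ : St.Carrier → St.Carrier
      σ s = apply s (swaps? s)

      σ-elim : (C : St.Carrier → Set) → ∀ s → (Swaps s → C (exchange s)) → (¬ Swaps s → C s) → C (σ s)
      σ-elim C s f g = go (swaps? s)
        where
        go : ∀ d → C (apply s d)
        go (yes w) = f w
        go (no ¬w) = g ¬w

      σ-cong : ∀ {s s′} → s St.≈ s′ → σ s St.≈ σ s′
      σ-cong {s} {s′} eq = σ-elim (λ t → t St.≈ σ s′) s
        (λ w → σ-elim (λ t → exchange s St.≈ t) s′ (λ _ → exchange-cong eq)
                 (λ ¬w → contradiction (swaps-cong eq w) ¬w))
        (λ ¬w → σ-elim (λ t → s St.≈ t) s′
                 (λ w → contradiction (swaps-cong (St.sym eq) w) ¬w) (λ _ → eq))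

      σ-involutive : ∀ s → σ (σ s) St.≈ s
      σ-involutive s = σ-elim (λ t → σ t St.≈ s) s
        (λ w → σ-elim (λ t → t St.≈ s) (exchange s) (λ _ → exchange-involutive s)
                 (λ ¬w → contradiction (swaps-exchange s w) ¬w))
        (λ ¬w → σ-elim (λ t → t St.≈ s) s (λ w → contradiction w ¬w) (λ _ → St.refl))

      σ-≅ : State ≅ State
      σ-≅ = mk≅ σ σ σ-cong σ-cong σ-involutive σ-involutive

      U′ : P → Bool
      U′ = mark i U

      U′-i : U′ i ≡ true
      U′-i rewrite dec-true (i ≟P i) refl = refl

      U′-other : ∀ {p} → p ≢ i → U′ p ≡ U p
      U′-other {p} p≢i rewrite dec-false (p ≟P i) p≢i = refl

      move-Class : ∀ s {p} → Class s p → move U s p ≡ e (g (proj₁ (proj₁ s)) i) (shared s)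
      move-Class s (up , q) rewrite up | q = refl

      move-i : ∀ s → move U s i ≡ e (g (proj₁ (proj₁ s)) i) (own s)
      move-i s rewrite Ui = refl

      move′-Class : ∀ s {p} → Class s p → move U′ s p ≡ e (g (proj₁ (proj₁ s)) i) (shared s)
      move′-Class s {p} (up , q) with p ≟P i
      ... | yes refl = refl
      ... | no _ rewrite up | q = refl

      move′-i : ∀ s → move U′ s i ≡ e (g (proj₁ (proj₁ s)) i) (shared s)
      move′-i s rewrite U′-i = refl

      move′-other : ∀ s {p} → p ≢ i → move U s p ≡ move U′ s p
      move′-other s p≢i rewrite U′-other p≢i = refl

      move′-agrees : ∀ s {p} → ¬ F.Stop s p → move U s p ≡ move U′ s p
      move′-agrees s ¬s = move′-other s (λ q → ¬s (inj₂ (inj₁ q)))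

      -- For the case that `i` is the root: marking then alters only the move of the root, which no
      -- orbit uses before its first arrival there.
      at-root : ∀ {r f f′} → (∀ {v} → v ≢ r → f v ≡ f′ v) → (∀ v → Reaches {P} f r v) → ∀ v → Reaches f′ r v
      at-root {r} eq rooted v with reaches-hit (_≟P r) refl (rooted v)
      ... | n , t , h with hit-map {S′ = _≡ r} id id eq h
      ... | h′ = n , trans (hit-iterate h′) (hit-∈ h′)

      forth : ∀ s → Rooted U s → Rooted U′ (σ s)
      forth s rooted = σ-elim (Rooted U′) s swapped kept
        where
        swapped : Swaps s → Rooted U′ (exchange s)
        -- Before marking, `i` moves by `own`, which therefore cannot lead back to `i`; so `shared`
        -- does.
        swapped (i≢r , l) = X.fuse-swap rooted
          ([ id , (λ l′ → contradiction l′ (X.¬b-leads-i rooted)) ]′ l) (cong (e _) (shared-exchange s))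
          where
          module X = F.Fusion s (class? s) {move U s} {move U′ (exchange s)} (λ _ → refl)
            (λ ¬s → trans (move-exchange s ¬s) (move′-agrees (exchange s) ¬s)) i≢r
            (move-Class s) (move-i s) (move′-Class (exchange s)) (move′-i (exchange s))
        kept : ¬ Swaps s → Rooted U′ s
        kept ¬w with i ≟P proj₂ s
        ... | yes refl = at-root (move′-other s) rooted
        ... | no i≢r = X.fuse-keep rooted (λ l → ¬w (i≢r , inj₁ l)) refl
          where
          module X = F.Fusion s (class? s) {move U s} {move U′ s} (λ _ → refl) (move′-agrees s) i≢r
            (move-Class s) (move-i s) (move′-Class s) (move′-i s)

      back : ∀ s → Rooted U′ s → Rooted U (σ s)
      back s rooted = σ-elim (Rooted U) s swapped kept
        where
        swapped : Swaps s → Rooted U (exchange s)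
        -- After marking, `i` moves by `shared`, so it is `own` that leads to `i`, and the exchange
        -- turns it into the shared choice.
        swapped (i≢r , l) = X.split-swap rooted
          (subst (Leads s) (sym (shared-exchange s))
            ([ (λ l′ → contradiction l′ (X.¬a′-leads-i rooted)) , id ]′ l)) (cong (e _) (own-exchange s))
          where
          module X = F.Fusion s (class? s) {move U (exchange s)} {move U′ s} (move-exchange s) (move′-agrees s) i≢r
            (move-Class (exchange s)) (move-i (exchange s)) (move′-Class s) (move′-i s)
        kept : ¬ Swaps s → Rooted U s
        kept ¬w with i ≟P proj₂ s
        ... | yes refl = at-root (λ v≢r → sym (move′-other s v≢r)) rooted
        ... | no i≢r = X.split-keep rooted (λ l → ¬w (i≢r , inj₂ l)) refl
          where
          module X = F.Fusion s (class? s) {move U s} {move U′ s} (λ _ → refl) (move′-agrees s) i≢r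
            (move-Class s) (move-i s) (move′-Class s) (move′-i s)

  rooted-≗ : ∀ {U U′} → U ≗ U′ → ∀ s → Rooted U s → Rooted U′ s
  rooted-≗ eq ((x , β , h) , r) rooted p = reaches-≗
    (λ v → cong (λ b → e (g x v) (if b then h (g x v) else β v)) (eq v)) (rooted p)

  mark-≅ : ∀ U i → Restrict State (Rooted U) ≅ Restrict State (Rooted (mark i U))
  mark-≅ U i with U i in Ui
  ... | false = restrict-≅ σ-≅ forth back where open Flip U i Ui
  ... | true = restrict-≅ ≅-id (rooted-≗ (λ p → sym (eq p))) (rooted-≗ eq)
    where
    eq : mark i U ≗ U
    eq p with p ≟P i
    ... | yes refl = sym Ui
    ... | no _ = refl

  marks : List P → P → Bool
  marks [] _ = false
  marks (i ∷ is) = mark i (marks is)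

  marks-≅ : ∀ is → Restrict State (Rooted (λ _ → false)) ≅ Restrict State (Rooted (marks is))
  marks-≅ [] = ≅-id
  marks-≅ (i ∷ is) = marks-≅ is ⟫ mark-≅ (marks is) i

  marks-∈ : ∀ {p is} → p ∈ is → marks is p ≡ true
  marks-∈ {p} (here refl) rewrite dec-true (p ≟P p) refl = refl
  marks-∈ {p} {i ∷ is} (there m) with does (p ≟P i)
  ... | true = refl
  ... | false = marks-∈ m

  merge : Restrict State (Rooted (λ _ → false)) ≅ Restrict State (Rooted (λ _ → true))
  merge = marks-≅ is ⟫ restrict-≅ ≅-id (rooted-≗ all-marked) (rooted-≗ (λ p → sym (all-marked p)))
    where
    module fin = Inverse (proj₂ finP)
    is : List P
    is = map fin.from (allFin (proj₁ finP))
    all-marked : marks is ≗ λ _ → true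
    all-marked p = marks-∈ (subst (_∈ is) (fin.strictlyInverseʳ p) (∈-map⁺ fin.from (∈-allFin (fin.to p))))

Bool-≡ : ∀ {a b : Bool} → (a ≡ true → b ≡ true) → (b ≡ true → a ≡ true) → a ≡ b
Bool-≡ {true} f g = sym (f refl)
Bool-≡ {false} {true} f g = g refl
Bool-≡ {false} {false} f g = refl

does-true : ∀ {A : Set} (d : Dec A) → does d ≡ true → A
does-true (yes a) _ = a

-- Walks and paths

module Graph {V : Set} (_≟_ : DecidableEquality V) (E : V → V → Bool) (E-sym : ∀ x y → E x y ≡ E y x) where

  -- With `A` equal to `(x ≢_)` these are the walks avoiding `x`, which detect the branches of a
  -- tree at `x`.
  data WalkIn (A : V → Set) : V → V → Set where
    here : ∀ {x} → A x → WalkIn A x x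
    step : ∀ {x y z} → A x → E x y ≡ true → WalkIn A y z → WalkIn A x z

  module _ {A : V → Set} where

    walk-end : ∀ {x y} → WalkIn A x y → A y
    walk-end (here a) = a
    walk-end (step _ _ w) = walk-end w

    _+++_ : ∀ {x y z} → WalkIn A x y → WalkIn A y z → WalkIn A x z
    here _ +++ w = w
    step a e v +++ w = step a e (v +++ w)

    walk-reverse : ∀ {x y} → WalkIn A x y → WalkIn A y x
    walk-reverse (here a) = here a
    walk-reverse (step {x} {y} a e w) =
      walk-reverse w +++ step (walk-start w) (trans (E-sym y x) e) (here a)
      where
      walk-start : ∀ {x y} → WalkIn A x y → A x
      walk-start (here a) = a
      walk-start (step a _ _) = a

  fromWalk : ∀ {x y} → Walk E x y → WalkIn (λ _ → ⊤) x y
  fromWalk here = here tt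
  fromWalk (step e w) = step tt e (fromWalk w)

  toWalk : ∀ {A x y} → WalkIn A x y → Walk E x y
  toWalk (here _) = here
  toWalk (step _ e w) = step e (toWalk w)

  data Path : V → V → List V → Set where
    here : ∀ {x} → Path x x (x ∷ [])
    step : ∀ {x y z vs} → E x y ≡ true → Path y z vs → All (x ≢_) vs → Path x z (x ∷ vs)

  path-walk : ∀ {A : V → Set} {x y vs} → Path x y vs → All A vs → WalkIn A x y
  path-walk here (a ∷ _) = here a
  path-walk (step e p _) (a ∷ as) = step a e (path-walk p as)

  path-unique : ∀ {x y vs} → Path x y vs → Unique vs
  path-unique here = [] ∷ []
  path-unique (step _ p a) = a ∷ path-unique p

  path-end-∈ : ∀ {x y vs} → Path x y vs → y ∈ vs
  path-end-∈ here = here refl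
  path-end-∈ (step _ p _) = there (path-end-∈ p)

  path-from : ∀ {A : V → Set} {x y z vs} → Path x z vs → All A vs → y ∈ vs → ∃ λ ws → Path y z ws × All A ws
  path-from p as (here refl) with p
  ... | here = _ , p , as
  ... | step _ _ _ = _ , p , as
  path-from (step _ p _) (_ ∷ as) (there m) = path-from p as m

  simplify : ∀ {A x y} → WalkIn A x y → ∃ λ vs → Path x y vs × All A vs
  simplify (here a) = _ , here , a ∷ []
  simplify (step {x} a e w) with simplify w
  ... | vs , p , as with memb? _≟_ x vs
  ... | yes m = path-from p as m
  ... | no ¬m = _ , step e p (¬Any⇒All¬ vs ¬m) , a ∷ as

  path-chain : ∀ {x y z vs} → Path x y vs → E y z ≡ true → EdgeChain E (vs ++ [ z ])
  path-chain here e = e , tt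
  path-chain (step e′ here a) e = e′ , e , tt
  path-chain (step e′ p@(step _ _ _) a) e = e′ , path-chain p e

  module Tree (acyclic : Acyclic E) where

    -- Otherwise x together with a simple path from y to y′ is a cycle.
    neighbours-joined : ∀ {x y y′} → E x y ≡ true → E x y′ ≡ true → WalkIn (x ≢_) y y′ → y ≡ y′
    neighbours-joined {x} {y} {y′} e e′ w with simplify w
    ... | _ , here , _ = refl
    ... | _ , p@(step _ q _) , as = ⊥-elim (acyclic x _ (long q , as ∷ path-unique p , chain))
      where
      long : ∀ {u v vs} → Path u v vs → 2 ≤ length (y ∷ vs)
      long here = s≤s (s≤s z≤n)
      long (step _ _ _) = s≤s (s≤s z≤n)
      chain : EdgeChain E (x ∷ (y ∷ _) ++ [ x ])
      chain = e , path-chain p (trans (E-sym y′ x) e′)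

    -- In a tree this is the neighbour of `x` on the way to `r`, described without first choosing a
    -- path.
    Parent : V → V → V → Set
    Parent r x y = E x y ≡ true × WalkIn (x ≢_) y r

    -- The two walks combine at `r` into one from `y` to `y′` that avoids `x`.
    parent-unique : ∀ {r x y y′} → Parent r x y → Parent r x y′ → y ≡ y′
    parent-unique (e , w) (e′ , w′) = neighbours-joined e e′ (w +++ walk-reverse w′)

    parent-≢ : ∀ {r x y} → Parent r x y → x ≢ r
    parent-≢ (_ , w) = walk-end w

    path-parent : ∀ {r x vs} → Path x r vs → x ≢ r → ∃ λ y → Parent r x y
    path-parent here x≢r = contradiction refl x≢r
    path-parent (step e p a) _ = _ , e , path-walk p a

    -- Follow a simple path from `y` to `r`. If it misses `x`, then `y` is the parent of `x`. If it
    -- meets `x`, its second vertex and `x` are neighbours of `y` joined by a walk avoiding `y`, so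
    -- they agree and `x` is the parent of `y`.
    edge-parent : (∀ x → E x x ≢ true) → Connected E → ∀ r {x y} → E x y ≡ true → Parent r x y ⊎ Parent r y x
    edge-parent irr conn r {x} {y} e with simplify (fromWalk (conn y r))
    ... | vs , p , _ with memb? _≟_ x vs
    ... | no x∉ = inj₁ (e , path-walk p (¬Any⇒All¬ vs x∉))
    edge-parent irr conn r {x} e | _ , here , _ | yes (here refl) = contradiction e (irr x)
    edge-parent irr conn r {x} e | _ , step _ _ _ , _ | yes (here refl) = contradiction e (irr x)
    edge-parent irr conn r {x} {y} e | _ , step e′ p a , _ | yes (there x∈)
      with neighbours-joined e′ (trans (E-sym y x) e) (path-before p a x∈)
      where
      path-before : ∀ {A u v w vs} → Path u v vs → All A vs → w ∈ vs → WalkIn A u w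
      path-before here (a ∷ _) (here refl) = here a
      path-before (step _ _ _) (a ∷ _) (here refl) = here a
      path-before (step e p _) (a ∷ as) (there m) = step a e (path-before p as m)
    ... | refl = inj₂ (e′ , path-walk p a)

-- Parent maps

module ParentMap {V : Set} (_≟_ : DecidableEquality V) (f : V → V) (r : V) (rooted : ∀ v → Reaches f r v) where

  open Rank _≟_ f r rooted

  -- The move of the root yields no edge; it becomes the extra choice that accompanies a tree.
  Up : V → V → Set
  Up x y = x ≢ r × f x ≡ y

  up? : ∀ x y → Dec (Up x y)
  up? x y = ¬? (x ≟ r) ×-dec (f x ≟ y)

  edge? : ∀ x y → Dec (Up x y ⊎ Up y x)
  edge? x y = up? x y ⊎-dec up? y x

  edge : V → V → Bool
  edge x y = does (edge? x y)

  edge-true : ∀ {x y} → Up x y ⊎ Up y x → edge x y ≡ true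
  edge-true = dec-true (edge? _ _)

  edge-up : ∀ {x y} → edge x y ≡ true → Up x y ⊎ Up y x
  edge-up = does-true (edge? _ _)

  edge-sym : ∀ x y → edge x y ≡ edge y x
  edge-sym x y = does-⇔ (mk⇔ Sum.swap Sum.swap) (edge? x y) (edge? y x)

  f≢ : ∀ {x} → x ≢ r → f x ≢ x
  f≢ x≢r e = <-irrefl (cong rank e) (rank-decreases x≢r)

  open Graph _≟_ edge edge-sym

  -- Ranks decrease along the parent walk, so it never returns to x.
  walk-avoiding : ∀ {x n v} → Hit f (_≡ r) n v r → x ≢ r → n < rank x → WalkIn (x ≢_) v r
  walk-avoiding (stop _) x≢r _ = here x≢r
  walk-avoiding {x} (step v≢r h) x≢r lt =
    step (λ { refl → <-irrefl (proj₁ (hit-unique (step v≢r h) (hit-root x))) lt })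
      (edge-true (inj₁ (v≢r , refl))) (walk-avoiding h x≢r (<-trans ≤-refl lt))

  parent-walk : ∀ {x} → x ≢ r → edge x (f x) ≡ true × WalkIn (x ≢_) (f x) r
  parent-walk x≢r = edge-true (inj₁ (x≢r , refl)) , walk-avoiding (hit-root _) x≢r (rank-decreases x≢r)

  to-root : ∀ {n v} → Hit f (_≡ r) n v r → WalkIn (λ _ → ⊤) v r
  to-root (stop _) = here tt
  to-root (step v≢r h) = step tt (edge-true (inj₁ (v≢r , refl))) (to-root h)

  edge-connected : Connected edge
  edge-connected x y = toWalk (to-root (hit-root x) +++ walk-reverse (to-root (hit-root y)))

  up-rank : ∀ {x y} → Up x y → rank y < rank x
  up-rank (x≢r , refl) = rank-decreases x≢r

  up-unique : ∀ {x y z} → Up x y → Up x z → y ≡ z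
  up-unique (_ , e) (_ , e′) = trans (sym e) e′

  NonBacktracking : List V → Set
  NonBacktracking (x ∷ vs@(_ ∷ z ∷ _)) = x ≢ z × NonBacktracking vs
  NonBacktracking _ = ⊤

  last : V → List V → V
  last x [] = x
  last x (y ∷ vs) = last y vs

  -- Along a non-backtracking walk a step away from the root can only be
  -- followed by steps away from the root.
  descending : ∀ {x y} vs {z} → Up y x → NonBacktracking (x ∷ y ∷ vs ++ [ z ]) →
    EdgeChain edge (y ∷ vs ++ [ z ]) → rank x < rank z × Up z (last y vs)
  descending [] u (x≢z , _) (e , _) with edge-up e
  ... | inj₁ u′ = contradiction (up-unique u u′) x≢z
  ... | inj₂ u′ = <-trans (up-rank u) (up-rank u′) , u′
  descending (w ∷ vs) u (x≢w , nb) (e , es) with edge-up e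
  ... | inj₁ u′ = contradiction (up-unique u u′) x≢w
  ... | inj₂ u′ with descending vs u′ nb es
  ... | lt , u″ = <-trans (up-rank u) lt , u″

  -- The walk climbs towards the root for a while and then only descends. Either it never turns and
  -- the rank drops, or its last step is a descent.
  climbing : ∀ {y} vs {z} → NonBacktracking (y ∷ vs ++ [ z ]) → EdgeChain edge (y ∷ vs ++ [ z ]) →
    rank z < rank y ⊎ Up z (last y vs)
  climbing [] _ (e , _) with edge-up e
  ... | inj₁ u = inj₁ (up-rank u)
  ... | inj₂ u = inj₂ u
  climbing (w ∷ vs) nb (e , es) with edge-up e
  ... | inj₂ u = inj₂ (proj₂ (descending vs u nb es))
  ... | inj₁ u with climbing vs (tail vs nb) es
    where
    tail : ∀ {y w z} vs → NonBacktracking (y ∷ w ∷ vs ++ [ z ]) → NonBacktracking (w ∷ vs ++ [ z ])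
    tail [] (_ , nb) = nb
    tail (_ ∷ _) (_ , nb) = nb
  ... | inj₁ lt = inj₁ (<-trans lt (up-rank u))
  ... | inj₂ u′ = inj₂ u′

  unique-nonbacktracking : ∀ {x} v vs → Unique (v ∷ vs) → All (x ≢_) (v ∷ vs) → NonBacktracking (v ∷ vs ++ [ x ])
  unique-nonbacktracking v [] _ _ = tt
  unique-nonbacktracking v (w ∷ []) _ (a ∷ _) = (λ e → a (sym e)) , tt
  unique-nonbacktracking v (w ∷ y ∷ vs) ((_ ∷ a ∷ _) ∷ u) (_ ∷ as) = a , unique-nonbacktracking w (y ∷ vs) u as

  edge-acyclic : Acyclic edge
  edge-acyclic x (v ∷ w ∷ vs) (_ , (x∉@(_ ∷ x≢w ∷ _) ∷ u@(v∉ ∷ _)) , e , es) with edge-up e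
  ... | inj₂ d = <-irrefl refl (proj₁ (descending (w ∷ vs) d (x≢w , unique-nonbacktracking v (w ∷ vs) u x∉) es))
  ... | inj₁ d with climbing (w ∷ vs) (unique-nonbacktracking v (w ∷ vs) u x∉) es
  ... | inj₁ lt = <-irrefl refl (<-trans lt (up-rank d))
  -- The cycle leaves `x` towards its parent and also returns from it, so the parent would occur
  -- twice among distinct vertices.
  ... | inj₂ d′ = All.lookup v∉ (last-∈ w vs) (up-unique d d′)
    where
    last-∈ : ∀ w vs → last w vs ∈ w ∷ vs
    last-∈ w [] = here refl
    last-∈ w (y ∷ vs) = there (last-∈ y vs)
  edge-acyclic x [] (() , _)
  edge-acyclic x (_ ∷ []) (s≤s () , _)

-- Rooted spanning trees as parent choices

-- A choice with target `v` itself means staying put, and several choices may do so; hence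
-- injectivity is asked at adjacent targets only.
module Choices {V C : Set} (_≟_ : DecidableEquality V) (Adj : V → V → Set)
  (adj-sym : ∀ {v w} → Adj v w → Adj w v) (adj-irrefl : ∀ {v} → ¬ Adj v v)
  (target : V → C → V) (target-adj : ∀ {v c} → target v c ≢ v → Adj v (target v c))
  (choice : ∀ {v w} → Adj v w → C) (target-choice : ∀ {v w} (a : Adj v w) → target v (choice a) ≡ w)
  (target-injective : ∀ {v c c′} → Adj v (target v c) → target v c ≡ target v c′ → c ≡ c′) where

  move : (V → C) → V → V
  move k v = target v (k v)

  Rooted : (V → C) × V → Set
  Rooted (k , r) = ∀ v → Reaches (move k) r v

  RootedChoices : Setoid 0ℓ 0ℓ
  RootedChoices = Restrict (×-setoid (V →-setoid C) (setoid V)) Rooted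

  private

    Trees : Setoid 0ℓ 0ℓ
    Trees = ×-setoid (RSTSetoid Adj) (setoid C)

    to : Carrier RootedChoices → Carrier Trees
    to ((k , r) , rooted) = ((edge , r) , edge-sym , edge-adj , edge-connected , edge-acyclic) , k r
      where
      open ParentMap _≟_ (move k) r rooted
      edge-adj : ∀ x y → edge x y ≡ true → Adj x y
      edge-adj x y e with edge-up e
      ... | inj₁ (x≢r , refl) = target-adj (f≢ x≢r)
      ... | inj₂ (y≢r , refl) = adj-sym (target-adj (f≢ y≢r))

    to-cong : ∀ {x y} → Setoid._≈_ RootedChoices x y → Setoid._≈_ Trees (to x) (to y)
    to-cong {(k , r) , rooted} {(k′ , _) , rooted′} (ke , refl) =
      ((λ x y → does-⇔ (mk⇔ (Sum.map (up ke) (up ke)) (Sum.map (up (λ v → sym (ke v))) (up (λ v → sym (ke v)))))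
          (A.edge? x y) (A′.edge? x y)) , refl) , ke r
      where
      module A = ParentMap _≟_ (move k) r rooted
      module A′ = ParentMap _≟_ (move k′) r rooted′
      up : ∀ {k k′ : V → C} {x y} → k ≗ k′ → x ≢ r × move k x ≡ y → x ≢ r × move k′ x ≡ y
      up {x = x} ke (x≢r , e) = x≢r , trans (cong (target x) (sym (ke x))) e

    to-injective : ∀ {x y} → Setoid._≈_ Trees (to x) (to y) → Setoid._≈_ RootedChoices x y
    to-injective {(k , r) , rooted} {(k′ , _) , rooted′} ((ee , refl) , ce) = ke , refl
      where
      module A = ParentMap _≟_ (move k) r rooted
      module A′ = ParentMap _≟_ (move k′) r rooted′
      module G = Graph _≟_ A.edge A.edge-sym
      module G′ = Graph _≟_ A′.edge A′.edge-sym
      convert : ∀ {B x y} → G′.WalkIn B x y → G.WalkIn B x y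
      convert (G′.here b) = G.here b
      convert (G′.step b e w) = G.step b (trans (ee _ _) e) (convert w)
      -- Off the root both maps give the parent of `v` in the same tree; at the root the recorded
      -- choice decides.
      ke : k ≗ k′
      ke v with v ≟ r
      ... | yes refl = ce
      ... | no v≢r = target-injective (target-adj (A.f≢ v≢r))
              (G.Tree.parent-unique A.edge-acyclic (A.parent-walk v≢r)
                (trans (ee _ _) (proj₁ (A′.parent-walk v≢r)) , convert (proj₂ (A′.parent-walk v≢r))))

    module FromTree (E : V → V → Bool) (r : V) (tree : IsSpanningTree Adj E) (c : C) where

      E-sym : ∀ x y → E x y ≡ E y x
      E-sym = proj₁ tree

      E-adj : ∀ x y → E x y ≡ true → Adj x y
      E-adj = proj₁ (proj₂ tree)

      connected : Connected E
      connected = proj₁ (proj₂ (proj₂ tree))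

      open Graph _≟_ E E-sym
      open Tree (proj₂ (proj₂ (proj₂ tree)))

      root-path : ∀ x → ∃ λ vs → Path x r vs
      root-path x with simplify (fromWalk (connected x r))
      ... | vs , p , _ = vs , p

      parent : ∀ {x} → x ≢ r → ∃ λ y → Parent r x y
      parent x≢r = path-parent (proj₂ (root-path _)) x≢r

      k : V → C
      k x with x ≟ r
      ... | yes _ = c
      ... | no x≢r = choice (E-adj _ _ (proj₁ (proj₂ (parent x≢r))))

      k-root : k r ≡ c
      k-root with r ≟ r
      ... | yes _ = refl
      ... | no r≢r = contradiction refl r≢r

      k-parent : ∀ {x y} → Parent r x y → move k x ≡ y
      k-parent {x} p with x ≟ r
      ... | yes x≡r = contradiction x≡r (parent-≢ p)
      ... | no x≢r = trans (target-choice _) (parent-unique (proj₂ (parent x≢r)) p)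

      path-reaches : ∀ {x vs} → Path x r vs → Reaches (move k) r x
      path-reaches here = 0 , refl
      path-reaches (step e p a) = reaches-step
        (subst (Reaches (move k) r) (sym (k-parent (e , path-walk p a))) (path-reaches p))

      rooted : Rooted (k , r)
      rooted x = path-reaches (proj₂ (root-path x))

      open ParentMap _≟_ (move k) r rooted

      edge-≡ : ∀ x y → edge x y ≡ E x y
      edge-≡ x y = Bool-≡ forth back
        where
        up-edge : ∀ {x y} → Up x y → E x y ≡ true
        up-edge {x} (x≢r , e) with parent x≢r
        ... | y′ , p = subst (λ z → E x z ≡ true) (trans (sym (k-parent p)) e) (proj₁ p)
        forth : edge x y ≡ true → E x y ≡ true
        forth e with edge-up e
        ... | inj₁ u = up-edge u
        ... | inj₂ u = trans (E-sym x y) (up-edge u)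
        back : E x y ≡ true → edge x y ≡ true
        back e with edge-parent (λ x e → adj-irrefl (E-adj x x e)) connected r e
        ... | inj₁ p = edge-true (inj₁ (parent-≢ p , k-parent p))
        ... | inj₂ p = edge-true (inj₂ (parent-≢ p , k-parent p))

  -- A tree fixes the move of every vertex but the root, namely towards its parent; the factor `C`
  -- supplies the choice at the root.
  trees-≅ : ×-setoid (RSTSetoid Adj) (setoid C) ≅ RootedChoices
  trees-≅ = ≅-sym (mk≅-injective {RootedChoices} {Trees} to
    (λ (((E , r) , t) , c) → (FromTree.k E r t c , r) , FromTree.rooted E r t c)
    (λ {x} {y} → to-cong {x} {y}) (λ {x} {y} → to-injective {x} {y})
    (λ (((E , r) , t) , c) → (FromTree.edge-≡ E r t c , refl) , FromTree.k-root E r t c))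

-- Rotating the root between the two levels

module _ {V : Set} (f : V → V) where

  iterate-+ : ∀ m n x → iterate f (m + n) x ≡ iterate f n (iterate f m x)
  iterate-+ zero n x = refl
  iterate-+ (suc m) n x = iterate-+ m n (f x)

  iterate-period : ∀ {x} k n → iterate f n x ≡ x → iterate f (k * n) x ≡ x
  iterate-period zero n e = refl
  iterate-period (suc k) n e = trans (iterate-+ n (k * n) _) (trans (cong (iterate f (k * n)) e) (iterate-period k n e))

  -- r and r′ both lie on the unique cycle, on which f is injective.
  root-injective : ∀ {r r′} → (∀ v → Reaches f r v) → (∀ v → Reaches f r′ v) → f r ≡ f r′ → r ≡ r′
  root-injective {r} {r′} rooted rooted′ e with rooted (f r) | rooted′ (f r′)
  ... | a , p | b , p′ = begin
    r                               ≡⟨ iterate-period (suc b) (suc a) p ⟨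
    -- The product of the two return times is a period of both points, and their orbits coincide
    -- after the first step.
    iterate f (suc b * suc a) r     ≡⟨ cong (iterate f (a + b * suc a)) e ⟩
    iterate f (suc b * suc a) r′    ≡⟨ cong (λ n → iterate f n r′) (*-comm (suc b) (suc a)) ⟩
    iterate f (suc a * suc b) r′    ≡⟨ iterate-period (suc a) (suc b) p′ ⟩
    r′                              ∎
    where open ≡-Reasoning

iterate-commute : ∀ {V W : Set} (φ : V → W) {f : V → V} {f′ : W → W} → (∀ v → φ (f v) ≡ f′ (φ v)) →
  ∀ n v → φ (iterate f n v) ≡ iterate f′ n (φ v)
iterate-commute φ e zero v = refl
iterate-commute φ {f} {f′} e (suc n) v = trans (iterate-commute φ e n (f v)) (cong (iterate f′ n) (e v))

module _ {P Q : Set} (Ω : Setoid 0ℓ 0ℓ) (G : Carrier Ω → P → Q) (H : Carrier Ω → Q → P)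
         (G-cong : ∀ {x y} → Setoid._≈_ Ω x y → G x ≗ G y)
         (H-cong : ∀ {x y} → Setoid._≈_ Ω x y → H x ≗ H y) where

  -- The inverse picks the point just before `r` on the cycle: from `H r`, follow `H ∘ G` for as
  -- many steps as `G ∘ H` needs to return from `G (H r)` to `r`.
  rotate : Restrict (×-setoid Ω (setoid P)) (λ (ω , r) → ∀ p → Reaches (H ω ∘ G ω) r p) ≅
           Restrict (×-setoid Ω (setoid Q)) (λ (ω , r) → ∀ q → Reaches (G ω ∘ H ω) r q)
  rotate = mk≅-injective
    (λ ((ω , r) , rooted) → (ω , G ω r) , λ q → push ω (rooted (H ω q)))
    (λ ((ω , r) , rooted) → (ω , pred ω r rooted) , pred-rooted ω r rooted)
    (λ { {(ω , r) , _} {(ω′ , _) , _} (e , refl) → e , G-cong e r })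
    (λ { {(ω , r) , rooted} {(ω′ , r′) , rooted′} (e , e′) → e ,
       root-injective (H ω ∘ G ω) rooted
         (λ p → reaches-≗ (λ v → sym (trans (H-cong e (G ω v)) (cong (H ω′) (G-cong e v)))) (rooted′ p))
         (cong (H ω) (trans e′ (sym (G-cong e r′)))) })
    (λ ((ω , r) , rooted) → Setoid.refl Ω , G-pred ω r rooted)
    where
    push : ∀ ω {r q} → Reaches (H ω ∘ G ω) r (H ω q) → Reaches (G ω ∘ H ω) (G ω r) q
    push ω (n , e) = suc n , trans (sym (iterate-commute (G ω) (λ _ → refl) n _)) (cong (G ω) e)
    pred : ∀ ω r → (∀ q → Reaches (G ω ∘ H ω) r q) → P
    pred ω r rooted = iterate (H ω ∘ G ω) (proj₁ (rooted (G ω (H ω r)))) (H ω r)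
    G-pred : ∀ ω r rooted → G ω (pred ω r rooted) ≡ r
    G-pred ω r rooted = trans (iterate-commute (G ω) (λ _ → refl) (proj₁ (rooted (G ω (H ω r)))) (H ω r)) (proj₂ (rooted _))
    pred-rooted : ∀ ω r rooted p → Reaches (H ω ∘ G ω) (pred ω r rooted) p
    pred-rooted ω r rooted p with rooted (G ω p)
    -- After `m` steps the image under `G` is `r`; one more step gives `H r`, and `n` further ones
    -- give `pred`.
    ... | m , e = m + suc n , trans (iterate-+ (H ω ∘ G ω) m (suc n) p)
                    (cong (λ q → iterate (H ω ∘ G ω) n (H ω q)) (trans (iterate-commute (G ω) (λ _ → refl) m p) e))
      where
      n : ℕ
      n = proj₁ (rooted (G ω (H ω r)))

-- Two-step moves in a bipartite graph

-- The factor `Q →-setoid A` is carried along so that the states of both levels consist of the same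
-- four choice functions.
module Bipartite {P Q A B : Set} (finP : Finite (setoid P)) (_≟P_ : DecidableEquality P)
                 (_≟Q_ : DecidableEquality Q) (u : P → A → Q) (d : Q → B → P) where

  open Merge finP _≟P_ _≟Q_ d (×-setoid (P →-setoid A) (Q →-setoid A))
    (λ x p → u p (proj₁ x p)) (λ e p → cong (u p) (proj₁ e p)) public

  Split Merged : Setoid 0ℓ 0ℓ
  Split = Restrict State (Rooted (λ _ → false))
  Merged = Restrict State (Rooted (λ _ → true))

  split-finite : Finite (setoid Q) → Finite (setoid A) → Finite (setoid B) → Finite Split
  split-finite finQ finA finB = restrict-finite
    (×-finite (×-finite (×-finite (→-finite finP finA) (→-finite finQ finA))
                        (×-finite (→-finite finP finB) (→-finite finQ finB))) finP)
    (λ s → ∀? finP (reaches? finP _≟P_ (move (λ _ → false) s) (proj₂ s)))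
    (λ { {((α , _) , _) , _} {((_ , β′ , _) , _)} (((αe , _) , βe , _) , refl) rooted p → reaches-≗
           (λ v → trans (cong (d (u v (α v))) (βe v)) (cong (λ a → d (u v a) (β′ v)) (αe v))) (rooted p) })

module _ {P Q A B : Set} (finP : Finite (setoid P)) (finQ : Finite (setoid Q))
         (_≟P_ : DecidableEquality P) (_≟Q_ : DecidableEquality Q) (u : P → A → Q) (d : Q → B → P) where

  private
    module L = Bipartite finP _≟P_ _≟Q_ u d
    module R = Bipartite finQ _≟Q_ _≟P_ d u

    Ω Ω′ : Setoid 0ℓ 0ℓ
    Ω = ×-setoid (×-setoid (P →-setoid A) (Q →-setoid A)) (×-setoid (P →-setoid B) (Q →-setoid B))
    Ω′ = ×-setoid (×-setoid (Q →-setoid B) (P →-setoid B)) (×-setoid (Q →-setoid A) (P →-setoid A))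

    regroup : ×-setoid Ω (setoid Q) ≅ ×-setoid Ω′ (setoid Q)
    regroup = mk≅
      (λ (((α , γ) , (β , h)) , r) → (((h , β) , (γ , α)) , r)) (λ (((h , β) , (γ , α)) , r) → (((α , γ) , (β , h)) , r))
      (λ (((α , γ) , (β , h)) , r) → (((h , β) , (γ , α)) , r)) (λ (((h , β) , (γ , α)) , r) → (((α , γ) , (β , h)) , r))
      (λ _ → Setoid.refl (×-setoid Ω′ (setoid Q))) (λ _ → Setoid.refl (×-setoid Ω (setoid Q)))

    -- Once merged, the moves are governed by `α` from P to Q and `h` from Q to P, so `rotate`
    -- applies. The own choices `β` of one level become carried data of the other, and conversely
    -- for `γ`.
    merged-≅ : L.Merged ≅ R.Merged
    merged-≅ = rotate Ω (λ ((α , _) , _) p → u p (α p)) (λ (_ , (_ , h)) q → d q (h q))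
                 (λ ((αe , _) , _) p → cong (u p) (αe p)) (λ (_ , (_ , he)) q → cong (d q) (he q))
               ⟫ restrict-≅ regroup (λ _ → id) (λ _ → id)

  split-≅ : L.Split ≅ R.Split
  split-≅ = L.merge ⟫ merged-≅ ⟫ ≅-sym R.merge

-- Fans and two-step paths

record Fan {P Q : Set} (R : P → Q → Set) (A : Set) : Set where
  field
    -- `A` lists the partners of all `p` uniformly: with `A = Fin a`, every `p` has exactly `a` of
    -- them.
    at : P → A → Q
    sound : ∀ p a → R p (at p a)
    index : ∀ {p q} → R p q → A
    at-index : ∀ {p q} (r : R p q) → at p (index r) ≡ q
    at-injective : ∀ {p a a′} → at p a ≡ at p a′ → a ≡ a′

-- For inclusion between consecutive levels this is `UD`, and for the reversed relation `DU`.
Path₂ : ∀ {P Q : Set} → (P → Q → Set) → P → Set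
Path₂ {P} {Q} R p = Σ (Q × P) λ z → R p (proj₁ z) × R (proj₂ z) (proj₁ z)

module _ {P Q A B : Set} {R : P → Q → Set} (F : Fan R A) (F′ : Fan (λ q p → R p q) B) where

  private
    module F = Fan F
    module F′ = Fan F′

  path₂-≅ : ΠSetoid P (Path₂ R) proj₁ ≅ (P →-setoid (A × B))
  path₂-≅ = ≅-sym (mk≅-injective {P →-setoid (A × B)} {ΠSetoid P (Path₂ R) proj₁}
    (λ k p → (F.at p (proj₁ (k p)) , F′.at (F.at p (proj₁ (k p))) (proj₂ (k p))) , F.sound _ _ , F′.sound _ _)
    (λ s p → F.index (proj₁ (proj₂ (s p))) , F′.index (proj₂ (proj₂ (s p))))
    (λ e p → cong (λ c → F.at p (proj₁ c) , F′.at (F.at p (proj₁ c)) (proj₂ c)) (e p))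
    (λ {k} {k′} e p → inj (k p) (k′ p) (e p))
    (λ s p → decode (proj₁ (proj₂ (s p))) (proj₂ (proj₂ (s p)))))
    where
    inj : ∀ {p} (c c′ : A × B) → (F.at p (proj₁ c) , F′.at (F.at p (proj₁ c)) (proj₂ c)) ≡
      (F.at p (proj₁ c′) , F′.at (F.at p (proj₁ c′)) (proj₂ c′)) → c ≡ c′
    inj (a , b) (a′ , b′) e with ,-injective e
    ... | e₁ , e₂ with F.at-injective e₁
    ... | refl = cong (a ,_) (F′.at-injective e₂)
    decode : ∀ {p q p′} (r : R p q) (r′ : R p′ q) →
      (F.at p (F.index r) , F′.at (F.at p (F.index r)) (F′.index r′)) ≡ (q , p′)
    decode r r′ = cong₂ _,_ (F.at-index r) (trans (cong (λ q → F′.at q (F′.index r′)) (F.at-index r)) (F′.at-index r′))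

-- `R` stands for inclusion, read in either direction. The last three hypotheses make adjacency of
-- distinct points the existence of a common partner, which is then unique: `X ∩ Z` on the upper
-- level, `Y ∪ Z` on the lower.
module Side {P Q A B : Set} {R : P → Q → Set} (F : Fan R A) (F′ : Fan (λ q p → R p q) B)
  (finP : Finite (setoid P)) (_≟P_ : DecidableEquality P) (_≟Q_ : DecidableEquality Q) (Adj : P → P → Set)
  (adj-sym : ∀ {v w} → Adj v w → Adj w v) (adj-irrefl : ∀ {v} → ¬ Adj v v)
  (meet-adj : ∀ {p p′ q} → p ≢ p′ → R p q → R p′ q → Adj p p′)
  (meet : ∀ {p p′} → Adj p p′ → ∃ λ q → R p q × R p′ q)
  (meet-unique : ∀ {p p′ q q′} → Adj p p′ → R p q → R p′ q → R p q′ → R p′ q′ → q ≡ q′) where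

  private
    module F = Fan F
    module F′ = Fan F′

    target : P → A × B → P
    target p (a , b) = F′.at (F.at p a) b

    choice : ∀ {p p′} → Adj p p′ → A × B
    choice adj = F.index (proj₁ (proj₂ (meet adj))) , F′.index (proj₂ (proj₂ (meet adj)))

    target-injective : ∀ {p} c c′ → Adj p (target p c) → target p c ≡ target p c′ → c ≡ c′
    target-injective {p} (a , b) (a′ , b′) adj e
      with F.at-injective (meet-unique adj (F.sound p a) (F′.sound _ b) (F.sound p a′)
             (subst (λ z → R z (F.at p a′)) (sym e) (F′.sound _ b′)))
    ... | refl = cong (a ,_) (F′.at-injective e)

  open Choices _≟P_ Adj adj-sym adj-irrefl target
    (λ {p} {c} ≢ → meet-adj (λ e → ≢ (sym e)) (F.sound p (proj₁ c)) (F′.sound _ (proj₂ c)))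
    choice
    (λ adj → trans (cong (λ q → F′.at q (proj₂ (choice adj))) (F.at-index (proj₁ (proj₂ (meet adj)))))
               (F′.at-index (proj₂ (proj₂ (meet adj)))))
    (λ {p} {c} {c′} → target-injective c c′)

  module Split = Bipartite finP _≟P_ _≟Q_ F.at F′.at

  private
    unzip : ×-setoid RootedChoices (Q →-setoid (B × A)) ≅ Split.Split
    unzip = mk≅
      (λ (((k , r) , w) , l) → (((proj₁ ∘ k , proj₂ ∘ l) , (proj₂ ∘ k , proj₁ ∘ l)) , r) , w)
      (λ ((((α , γ) , (β , h)) , r) , w) → (((λ p → α p , β p) , r) , w) , λ q → h q , γ q)
      (λ ((ke , re) , le) → (((λ p → cong proj₁ (ke p)) , (λ q → cong proj₂ (le q))) ,
                             ((λ p → cong proj₂ (ke p)) , (λ q → cong proj₁ (le q)))) , re)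
      (λ (((αe , γe) , (βe , he)) , re) → ((λ p → cong₂ _,_ (αe p) (βe p)) , re) , (λ q → cong₂ _,_ (he q) (γe q)))
      (λ _ → (((λ _ → refl) , (λ _ → refl)) , ((λ _ → refl) , (λ _ → refl))) , refl)
      (λ _ → ((λ _ → refl) , refl) , (λ _ → refl))

  -- The factor `A × B` is the choice at the root that turns trees into choice functions; `unzip`
  -- regroups all pairs into the four functions of a state.
  side-≅ : ×-setoid (×-setoid (RSTSetoid Adj) (ΠSetoid Q (Path₂ (λ q p → R p q)) proj₁)) (setoid (A × B)) ≅ Split.Split
  side-≅ = ×-exchange ⟫ (trees-≅ ×-inverse path₂-≅ F′ F) ⟫ unzip

-- Subsets of a finite set

⊆-∣≡∣ : ∀ {n} {p q : Subset n} → p ⊆ q → ∣ p ∣ ≡ ∣ q ∣ → p ≡ q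
⊆-∣≡∣ {p = []} {[]} _ _ = refl
⊆-∣≡∣ {p = outside ∷ p} {outside ∷ q} s e = cong (outside ∷_) (⊆-∣≡∣ (drop-∷-⊆ s) e)
⊆-∣≡∣ {p = outside ∷ p} {inside ∷ q} s e = contradiction (subst (_≤ ∣ q ∣) e (p⊆q⇒∣p∣≤∣q∣ (drop-∷-⊆ s))) (n≮n _)
⊆-∣≡∣ {p = inside ∷ p} {outside ∷ q} s e with s here
... | ()
⊆-∣≡∣ {p = inside ∷ p} {inside ∷ q} s e = cong (inside ∷_) (⊆-∣≡∣ (drop-∷-⊆ s) (ℕ-suc-injective e))

∣∪∣+∣∩∣ : ∀ {n} (p q : Subset n) → ∣ p ∪ q ∣ + ∣ p ∩ q ∣ ≡ ∣ p ∣ + ∣ q ∣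
∣∪∣+∣∩∣ [] [] = refl
∣∪∣+∣∩∣ (outside ∷ p) (outside ∷ q) = ∣∪∣+∣∩∣ p q
∣∪∣+∣∩∣ (outside ∷ p) (inside ∷ q) = trans (cong suc (∣∪∣+∣∩∣ p q)) (sym (+-suc _ _))
∣∪∣+∣∩∣ (inside ∷ p) (outside ∷ q) = cong suc (∣∪∣+∣∩∣ p q)
∣∪∣+∣∩∣ (inside ∷ p) (inside ∷ q) = cong suc (trans (+-suc _ _) (trans (cong suc (∣∪∣+∣∩∣ p q)) (sym (+-suc _ _))))

-- The index runs over the elements of `p`, not over positions; that of `add` runs over the elements
-- missing from `p`.
remove : ∀ {n} (p : Subset n) → Fin ∣ p ∣ → Subset n
remove (outside ∷ p) i = outside ∷ remove p i
remove (inside ∷ p) zero = outside ∷ p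
remove (inside ∷ p) (suc i) = inside ∷ remove p i

remove-⊆ : ∀ {n} (p : Subset n) i → remove p i ⊆ p
remove-⊆ (outside ∷ p) i = s⊆s (remove-⊆ p i)
remove-⊆ (inside ∷ p) zero = out⊆ ⊆-refl
remove-⊆ (inside ∷ p) (suc i) = s⊆s (remove-⊆ p i)

∣remove∣ : ∀ {n} (p : Subset n) i → suc ∣ remove p i ∣ ≡ ∣ p ∣
∣remove∣ (outside ∷ p) i = ∣remove∣ p i
∣remove∣ (inside ∷ p) zero = refl
∣remove∣ (inside ∷ p) (suc i) = cong suc (∣remove∣ p i)

remove-injective : ∀ {n} (p : Subset n) i j → remove p i ≡ remove p j → i ≡ j
remove-injective (outside ∷ p) i j e = remove-injective p i j (∷-injectiveʳ e)
remove-injective (inside ∷ p) zero zero e = refl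
remove-injective (inside ∷ p) (suc i) (suc j) e = cong suc (remove-injective p i j (∷-injectiveʳ e))

removed : ∀ {n} {p q : Subset n} → q ⊆ p → suc ∣ q ∣ ≡ ∣ p ∣ → ∃ λ i → remove p i ≡ q
removed {p = outside ∷ p} {outside ∷ q} s e with removed (drop-∷-⊆ s) e
... | i , e′ = i , cong (outside ∷_) e′
removed {p = outside ∷ p} {inside ∷ q} s e with s here
... | ()
removed {p = inside ∷ p} {outside ∷ q} s e = zero , cong (outside ∷_) (sym (⊆-∣≡∣ (drop-∷-⊆ s) (ℕ-suc-injective e)))
removed {p = inside ∷ p} {inside ∷ q} s e with removed (drop-∷-⊆ s) (ℕ-suc-injective e)
... | i , e′ = suc i , cong (inside ∷_) e′

add : ∀ {n} (p : Subset n) → Fin ∣ ∁ p ∣ → Subset n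
add (inside ∷ p) i = inside ∷ add p i
add (outside ∷ p) zero = inside ∷ p
add (outside ∷ p) (suc i) = outside ∷ add p i

add-⊇ : ∀ {n} (p : Subset n) i → p ⊆ add p i
add-⊇ (inside ∷ p) i = s⊆s (add-⊇ p i)
add-⊇ (outside ∷ p) zero = out⊆ ⊆-refl
add-⊇ (outside ∷ p) (suc i) = s⊆s (add-⊇ p i)

∣add∣ : ∀ {n} (p : Subset n) i → ∣ add p i ∣ ≡ suc ∣ p ∣
∣add∣ (inside ∷ p) i = cong suc (∣add∣ p i)
∣add∣ (outside ∷ p) zero = refl
∣add∣ (outside ∷ p) (suc i) = ∣add∣ p i

add-injective : ∀ {n} (p : Subset n) i j → add p i ≡ add p j → i ≡ j
add-injective (inside ∷ p) i j e = add-injective p i j (∷-injectiveʳ e)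
add-injective (outside ∷ p) zero zero e = refl
add-injective (outside ∷ p) (suc i) (suc j) e = cong suc (add-injective p i j (∷-injectiveʳ e))

added : ∀ {n} {p q : Subset n} → p ⊆ q → suc ∣ p ∣ ≡ ∣ q ∣ → ∃ λ i → add p i ≡ q
added {p = inside ∷ p} {inside ∷ q} s e with added (drop-∷-⊆ s) (ℕ-suc-injective e)
... | i , e′ = i , cong (inside ∷_) e′
added {p = inside ∷ p} {outside ∷ q} s e with s here
... | ()
added {p = outside ∷ p} {inside ∷ q} s e = zero , cong (inside ∷_) (⊆-∣≡∣ (drop-∷-⊆ s) (ℕ-suc-injective e))
added {p = outside ∷ p} {outside ∷ q} s e with added (drop-∷-⊆ s) e
... | i , e′ = suc i , cong (outside ∷_) e′

-- Levels of the Boolean lattice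

module _ {n k : ℕ} where

  B-≡ : {X Y : B n k} → proj₁ X ≡ proj₁ Y → X ≡ Y
  B-≡ {X , e} {_ , e′} refl = cong (X ,_) (≡-irrelevant e e′)

  B-⊆-≡ : {X Y : B n k} → proj₁ X ⊆ proj₁ Y → X ≡ Y
  B-⊆-≡ {X , e} {Y , e′} s = B-≡ (⊆-∣≡∣ s (trans e (sym e′)))

  _≟B_ : DecidableEquality (B n k)
  X ≟B Y = map′ B-≡ (cong proj₁) (≡-dec _≟ᵇ_ (proj₁ X) (proj₁ Y))

Bool-finite : Finite (setoid Bool)
Bool-finite = 2 , mk≅ (if_then suc zero else zero) (λ { zero → false ; (suc _) → true })
  (cong _) (cong _) (λ { zero → refl ; (suc zero) → refl }) (λ { false → refl ; true → refl })

Subset-finite : ∀ n → Finite (setoid (Subset n))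
Subset-finite zero = 1 , mk≅ (λ _ → zero) (λ _ → []) (λ _ → refl) (λ _ → refl) (λ { zero → refl }) (λ { [] → refl })
Subset-finite (suc n) = _ , (uncons ⟫ proj₂ (×-finite Bool-finite (Subset-finite n)))
  where
  uncons : setoid (Subset (suc n)) ≅ ×-setoid (setoid Bool) (setoid (Subset n))
  uncons = mk≅ (λ { (b ∷ p) → b , p }) (λ (b , p) → b ∷ p)
    (λ { {_ ∷ _} refl → refl , refl }) (λ { (refl , refl) → refl }) (λ _ → refl , refl) (λ { (_ ∷ _) → refl })

B-finite : ∀ n k → Finite (setoid (B n k))
B-finite n k = _ , (i ⟫ proj₂ (restrict-finite (Subset-finite n) (λ X → ∣ X ∣ ≟ℕ k) (λ { refl → id })))
  where
  i : setoid (B n k) ≅ Restrict (setoid (Subset n)) (λ X → ∣ X ∣ ≡ k)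
  i = mk≅ id id (cong proj₁) B-≡ (λ _ → refl) (λ _ → refl)

module _ {n k : ℕ} where

  Above : B n (suc k) → B n k → Set
  Above X Y = proj₁ Y ⊆ proj₁ X

  down : Fan Above (Fin (suc k))
  down = record
    { at = λ (X , e) i → remove X (cast (sym e) i) , ℕ-suc-injective (trans (∣remove∣ X _) e)
    ; sound = λ (X , e) i → remove-⊆ X _
    ; index = λ { {X , e} {Y , e′} s → cast e (proj₁ (removed s (trans (cong suc e′) (sym e)))) }
    ; at-index = λ { {X , e} {Y , e′} s → B-≡ (trans (cong (remove X) (cast-involutive (sym e) e _))
                       (proj₂ (removed s (trans (cong suc e′) (sym e))))) }
    ; at-injective = λ { {X , e} {i} {j} eq → trans (sym (cast-involutive e (sym e) i))
        (trans (cong (cast e) (remove-injective X _ _ (cong proj₁ eq))) (cast-involutive e (sym e) j)) }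
    }

  -- The number n - k of supersets is written as a successor so that the factor to be cancelled is
  -- visibly nonzero.
  up : suc k ≤ n → Fan (λ Y X → Above X Y) (Fin (suc (n ∸ suc k)))
  up k<n = record
    { at = λ (Y , e) i → add Y (cast (sym (size Y e)) i) , trans (∣add∣ Y _) (cong suc e)
    ; sound = λ (Y , e) i → add-⊇ Y _
    ; index = λ { {Y , e} {X , e′} s → cast (size Y e) (proj₁ (added s (trans (cong suc e) (sym e′)))) }
    ; at-index = λ { {Y , e} {X , e′} s → B-≡ (trans (cong (add Y) (cast-involutive (sym (size Y e)) (size Y e) _))
                       (proj₂ (added s (trans (cong suc e) (sym e′))))) }
    ; at-injective = λ { {Y , e} {i} {j} eq → trans (sym (cast-involutive (size Y e) (sym (size Y e)) i))
        (trans (cong (cast (size Y e)) (add-injective Y _ _ (cong proj₁ eq)))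
          (cast-involutive (size Y e) (sym (size Y e)) j)) }
    }
    where
    size : ∀ (Y : Subset n) → ∣ Y ∣ ≡ k → ∣ ∁ Y ∣ ≡ suc (n ∸ suc k)
    size Y e = trans (∣∁p∣≡n∸∣p∣ Y) (trans (cong (n ∸_) e) (+-∸-assoc 1 k<n))

  ∩-greatest : ∀ {X Z : B n (suc k)} {Y} → Above X Y → Above Z Y → proj₁ Y ⊆ proj₁ X ∩ proj₁ Z
  ∩-greatest s s′ y = x∈p∩q⁺ (s y , s′ y)

  ∪-least : ∀ {X : B n (suc k)} {Y Z} → Above X Y → Above X Z → proj₁ Y ∪ proj₁ Z ⊆ proj₁ X
  ∪-least {Y = Y} {Z} s s′ y = [ s , s′ ]′ (x∈p∪q⁻ (proj₁ Y) (proj₁ Z) y)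

module _ {n k : ℕ} where

  JAdj-sym : ∀ {X Y : B n k} → JAdj n k X Y → JAdj n k Y X
  JAdj-sym {X , _} {Y , _} = trans (cong (λ Z → suc ∣ Z ∣) (∩-comm Y X))

  JAdj-irrefl : ∀ {X : B n k} → ¬ JAdj n k X X
  JAdj-irrefl {X , e} a = n≮n k (subst (suc k ≤_)
    (trans (cong suc (sym e)) (trans (cong (λ Z → suc ∣ Z ∣) (sym (∩-idem X))) a)) ≤-refl)

  -- Inclusion-exclusion: 2k - (k - 1) = k + 1.
  ∪-size : ∀ {Y Z : B n k} → JAdj n k Y Z → ∣ proj₁ Y ∪ proj₁ Z ∣ ≡ suc k
  ∪-size {Y , e} {Z , e′} a = +-cancelʳ-≡ ∣ Y ∩ Z ∣ _ _ (trans (∣∪∣+∣∩∣ Y Z)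
    (trans (cong₂ _+_ e (trans e′ (sym a))) (+-suc k _)))

  ∪-size⁻ : ∀ {Y Z : B n k} → ∣ proj₁ Y ∪ proj₁ Z ∣ ≡ suc k → JAdj n k Y Z
  ∪-size⁻ {Y , e} {Z , e′} s = +-cancelˡ-≡ k _ _ (trans (+-suc k _)
    (trans (cong (_+ ∣ Y ∩ Z ∣) (sym s)) (trans (∣∪∣+∣∩∣ Y Z) (cong₂ _+_ e e′))))

module _ {n k : ℕ} where

  -- `X ∩ Z` contains `Y`, so it has at least k elements; with k + 1 it would be all of `X`, forcing
  -- `X ≡ Z`.
  meet-adj : ∀ {X Z : B n (suc k)} {Y} → X ≢ Z → Above X Y → Above Z Y → JAdj n (suc k) X Z
  meet-adj {X , e} {Z , e′} {Y , f} X≢Z s s′ = cong suc (≤-antisym (m<1+n⇒m≤n lt)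
    (subst (_≤ ∣ X ∩ Z ∣) f (p⊆q⇒∣p∣≤∣q∣ (∩-greatest {X = X , e} {Z , e′} {Y , f} s s′))))
    where
    lt : ∣ X ∩ Z ∣ < suc k
    lt = ≤∧≢⇒< (subst (∣ X ∩ Z ∣ ≤_) e (p⊆q⇒∣p∣≤∣q∣ (p∩q⊆p X Z)))
      (λ eq → X≢Z (B-⊆-≡ (subst (_⊆ Z) (⊆-∣≡∣ (p∩q⊆p X Z) (trans eq (sym e))) (p∩q⊆q X Z))))

  meet : ∀ {X Z : B n (suc k)} → JAdj n (suc k) X Z → ∃ λ Y → Above X Y × Above Z Y
  meet {X , _} {Z , _} a = (X ∩ Z , ℕ-suc-injective a) , p∩q⊆p X Z , p∩q⊆q X Z

  meet-unique : ∀ {X Z : B n (suc k)} {Y Y′} → JAdj n (suc k) X Z →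
    Above X Y → Above Z Y → Above X Y′ → Above Z Y′ → Y ≡ Y′
  meet-unique {X} {Z} {Y} {Y′} a s s′ t t′ = trans (is-meet Y s s′) (sym (is-meet Y′ t t′))
    where
    is-meet : ∀ Y → Above X Y → Above Z Y → Y ≡ proj₁ (meet {X} {Z} a)
    is-meet Y s s′ = B-⊆-≡ (∩-greatest {X = X} {Z} {Y} s s′)

  -- `Y ∪ Z` lies in `X`, so it has at most k + 1 elements; with only k it would be `Y`, forcing
  -- `Y ≡ Z`.
  join-adj : ∀ {Y Z : B n k} {X : B n (suc k)} → Y ≢ Z → Above X Y → Above X Z → JAdj n k Y Z
  join-adj {Y , e} {Z , e′} {X , f} Y≢Z s s′ = ∪-size⁻ {Y = Y , e} {Z , e′} (≤-antisym
    (subst (∣ Y ∪ Z ∣ ≤_) f (p⊆q⇒∣p∣≤∣q∣ (∪-least {X = X , f} {Y , e} {Z , e′} s s′)))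
    (≤∧≢⇒< (subst (_≤ ∣ Y ∪ Z ∣) e (p⊆q⇒∣p∣≤∣q∣ (p⊆p∪q {p = Y} Z)))
      (λ eq → Y≢Z (sym (B-⊆-≡ (subst (Z ⊆_) (sym (⊆-∣≡∣ (p⊆p∪q {p = Y} Z) (trans e eq))) (q⊆p∪q Y Z)))))))

  join : ∀ {Y Z : B n k} → JAdj n k Y Z → ∃ λ (X : B n (suc k)) → Above X Y × Above X Z
  join {Y , e} {Z , e′} a = (Y ∪ Z , ∪-size {Y = Y , e} {Z , e′} a) , p⊆p∪q {p = Y} Z , q⊆p∪q Y Z

  join-unique : ∀ {Y Z : B n k} {X X′ : B n (suc k)} → JAdj n k Y Z →
    Above X Y → Above X Z → Above X′ Y → Above X′ Z → X ≡ X′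
  join-unique {Y} {Z} {X} {X′} a s s′ t t′ = trans (sym (is-join X s s′)) (is-join X′ t t′)
    where
    is-join : ∀ X → Above X Y → Above X Z → proj₁ (join {Y} {Z} a) ≡ X
    is-join X s s′ = B-⊆-≡ (∪-least {X = X} {Y} {Z} s s′)

-- Cancelling the choices at the root

Fin×Fin-card : ∀ {M N} → Card (setoid (Fin M × Fin N)) (M * N)
Fin×Fin-card {M} {N} = ≅-sym (*↔× {M} {N})

theorem3p4 : (n m : ℕ) → 1 ≤ m → 2 * m ≤ n →
    Inverse (×-setoid (T n m) (∏DU n m)) (×-setoid (T n (m ∸ 1)) (∏UD n m))
theorem3p4 n (suc k) _ 2m≤n = ×-cancel
  -- Finiteness is taken from the split states, which are cut out of finite function spaces.
  (_ , (Upper.side-≅ ⟫ proj₂ (Upper.Split.split-finite (B-finite n k) fin fin)))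
  -- The swap puts the factors k + 1 and n - k in the same order on both sides.
  Fin×Fin-card (swap-≅ ⟫ Fin×Fin-card)
  (Upper.side-≅
    ⟫ split-≅ (B-finite n (suc k)) (B-finite n k) _≟B_ _≟B_ (Fan.at down) (Fan.at (up k<n))
    ⟫ ≅-sym Lower.side-≅)
  where
  k<n : suc k ≤ n
  k<n = ≤-trans (m≤m+n (suc k) _) 2m≤n
  fin : ∀ {N} → Finite (setoid (Fin N))
  fin = _ , ≅-id
  swap-≅ : ∀ {A B : Set} → setoid (A × B) ≅ setoid (B × A)
  swap-≅ = mk≅ swap swap (cong swap) (cong swap) (λ _ → refl) (λ _ → refl)
  module Upper = Side down (up k<n) (B-finite n (suc k)) _≟B_ _≟B_ (JAdj n (suc k))
    (λ {X} {Z} → JAdj-sym {X = X} {Z}) (λ {X} → JAdj-irrefl {X = X})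
    (λ {X} {Z} {Y} → meet-adj {X = X} {Z} {Y}) (λ {X} {Z} → meet {X = X} {Z})
    (λ {X} {Z} {Y} {Y′} a s s′ t t′ → meet-unique {X = X} {Z} {Y} {Y′} a s s′ t t′)
  module Lower = Side (up k<n) down (B-finite n k) _≟B_ _≟B_ (JAdj n k)
    (λ {X} {Z} → JAdj-sym {X = X} {Z}) (λ {X} → JAdj-irrefl {X = X})
    (λ {Y} {Z} {X} → join-adj {Y = Y} {Z} {X}) (λ {Y} {Z} → join {Y = Y} {Z})
    (λ {Y} {Z} {X} {X′} a s s′ t t′ → join-unique {Y = Y} {Z} {X} {X′} a s s′ t t′)
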